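{- The variety $\mathsf{RQEA}_\omega$ of representable quasi-polyadic equality algebras of dimension $\omega$ cannot be axiomatized over $\mathsf{RQA}_\omega$ by a set of universal formulas containing only finitely many variables; that is, there is no set $\Sigma$ of universal first-order formulas in the signature of $\mathsf{QEA}_\omega$, using altogether only finitely many variables and valid in $\mathsf{RQEA}_\omega$, such that every algebra $\mathfrak A$ of the $\mathsf{QEA}_\omega$ signature with $\mathfrak A\models\Sigma$ and whose quasi-polyadic (diagonal-free) reduct lies in $\mathsf{RQA}_\omega$ belongs to $\mathsf{RQEA}_\omega$.
   Context: The signature of $\mathsf{QEA}_\omega$ consists of the Boolean operations, cylindrifiers $\mathsf c_i$, diagonal constants $\mathsf d_{ij}$, and substitutions $\mathsf s_{[i/j]}$ (replacements) and $\mathsf s_{[i,j]}$ (transpositions) for $i,j<\omega$; the signature of $\mathsf{QA}_\omega$ is the same without the diagonal constants. $\mathsf{RQEA}_\omega$ and $\mathsf{RQA}_\omega$ are the classes of representable quasi-polyadic equality algebras, resp. representable quasi-polyadic algebras, of dimension $\omega$. In general, for varieties $\mathsf K$ of signature $t$ and $\mathsf L$ of signature $t'\subseteq t$, a set $\Sigma$ of formulas of signature $t$ axiomatizes $\mathsf K$ over $\mathsf L$ if for every $t$-algebra $\mathfrak A$, $\mathfrak A\models\Sigma$ and $\mathrm{Rd}_{t'}\mathfrak A\in\mathsf L$ imply $\mathfrak A\in\mathsf K$. -}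

module Defs where

open import Data.Bool using (if_then_else_)
open import Data.Fin using (Fin; zero; suc)
open import Data.List using (List)
open import Data.List.Membership.Propositional using () renaming (_∈_ to _∈ˡ_)
open import Data.Nat using (ℕ; _≟_)
open import Data.Product using (Σ-syntax; ∃-syntax; _×_; _,_; proj₁; proj₂)
open import Data.Sum using (_⊎_; map)
open import Function using (_∘_)
open import Function.Definitions using (Congruent; Injective)
open import Level using (Level; _⊔_; Lift) renaming (suc to lsuc)
open import Relation.Binary using (Setoid; IsEquivalence)
open import Relation.Binary.PropositionalEquality using (_≡_)
open import Relation.Nullary using (¬_; does)
open import Relation.Unary using (Pred; _∈_; _∩_; _∪_; ∁; _≐_; _⊢_)
open import Relation.Unary.Polymorphic using (∅; U)
open import Relation.Unary.Relation.Binary.Equality using (≐-setoid)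

------------------------------------------------------------------------
-- Universal algebra

record Signature : Set₁ where
  field
    Op    : Set
    arity : Op → ℕ

open Signature public

-- Algebras carry a setoid equality; `op-cong` makes every basic operation
-- well defined on the quotient.
record Algebra (S : Signature) (c ℓ : Level) : Set (lsuc (c ⊔ ℓ)) where
  field
    setoid : Setoid c ℓ

  open Setoid setoid public using (Carrier; _≈_; isEquivalence)

  field
    op      : (f : Op S) → (Fin (arity S f) → Carrier) → Carrier
    op-cong : (f : Op S) {xs ys : Fin (arity S f) → Carrier} →
              (∀ i → xs i ≈ ys i) → op f xs ≈ op f ys

-- An embedding exhibits A as isomorphic to a subalgebra of B.
record Embedding {S : Signature} {a ℓ₁ b ℓ₂ : Level}
                 (A : Algebra S a ℓ₁) (B : Algebra S b ℓ₂) :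
                 Set (a ⊔ ℓ₁ ⊔ b ⊔ ℓ₂) where
  private
    module A = Algebra A
    module B = Algebra B
  field
    to        : A.Carrier → B.Carrier
    congruent : Congruent A._≈_ B._≈_ to
    homo      : ∀ f xs → to (A.op f xs) B.≈ B.op f (to ∘ xs)
    injective : Injective A._≈_ B._≈_ to

Product : {S : Signature} {κ c ℓ : Level} (K : Set κ) →
          (K → Algebra S c ℓ) → Algebra S (κ ⊔ c) (κ ⊔ ℓ)
Product K A = record
  { setoid = record
    { Carrier       = ∀ k → Algebra.Carrier (A k)
    ; _≈_           = λ x y → ∀ k → Algebra._≈_ (A k) (x k) (y k)
    ; isEquivalence = record
      { refl  = λ k → IsEquivalence.refl (Algebra.isEquivalence (A k))
      ; sym   = λ p k → IsEquivalence.sym (Algebra.isEquivalence (A k)) (p k)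
      ; trans = λ p q k →
                  IsEquivalence.trans (Algebra.isEquivalence (A k)) (p k) (q k)
      }
    }
  ; op      = λ f xs k → Algebra.op (A k) f (λ i → xs i k)
  ; op-cong = λ f p k → Algebra.op-cong (A k) f (λ i → p i k)
  }

------------------------------------------------------------------------
-- Universal formulas (with equality) over the variables x₀, x₁, x₂, …

-- The function that sends i to a and otherwise agrees with v.
_[_≔_] : {a : Level} {A : Set a} → (ℕ → A) → ℕ → A → (ℕ → A)
(v [ i ≔ a ]) k = if does (i ≟ k) then a else v k

data Term (S : Signature) : Set where
  var : ℕ → Term S
  app : (f : Op S) → (Fin (arity S f) → Term S) → Term S

data QuantifierFree (S : Signature) : Set where
  _≗_         : Term S → Term S → QuantifierFree S
  neg         : QuantifierFree S → QuantifierFree S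
  and or impl : QuantifierFree S → QuantifierFree S → QuantifierFree S

data UniversalFormula (S : Signature) : Set where
  qf  : QuantifierFree S → UniversalFormula S
  all : ℕ → UniversalFormula S → UniversalFormula S

module Semantics {S : Signature} {c ℓ : Level} (A : Algebra S c ℓ) where
  open Algebra A

  ⟦_⟧ : Term S → (ℕ → Carrier) → Carrier
  ⟦ var x    ⟧ v = v x
  ⟦ app f ts ⟧ v = op f (λ i → ⟦ ts i ⟧ v)

  HoldsQF : QuantifierFree S → (ℕ → Carrier) → Set ℓ
  HoldsQF (t ≗ t′)   v = ⟦ t ⟧ v ≈ ⟦ t′ ⟧ v
  HoldsQF (neg φ)    v = ¬ HoldsQF φ v
  HoldsQF (and φ ψ)  v = HoldsQF φ v × HoldsQF ψ v
  HoldsQF (or φ ψ)   v = HoldsQF φ v ⊎ HoldsQF ψ v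
  HoldsQF (impl φ ψ) v = HoldsQF φ v → HoldsQF ψ v

  Holds : UniversalFormula S → (ℕ → Carrier) → Set (c ⊔ ℓ)
  Holds (qf φ)    v = Lift c (HoldsQF φ v)
  Holds (all x φ) v = ∀ a → Holds φ (v [ x ≔ a ])

infix 4 _⊨_

_⊨_ : {S : Signature} {c ℓ s : Level} →
      Algebra S c ℓ → Pred (UniversalFormula S) s → Set (c ⊔ ℓ ⊔ s)
A ⊨ Γ = ∀ φ → φ ∈ Γ → ∀ v → Semantics.Holds A φ v

-- All variables occurring, free or bound, belong to the list V.
TermVarsIn : {S : Signature} → List ℕ → Term S → Set
TermVarsIn V (var x)    = x ∈ˡ V
TermVarsIn V (app f ts) = ∀ i → TermVarsIn V (ts i)

QFVarsIn : {S : Signature} → List ℕ → QuantifierFree S → Set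
QFVarsIn V (t ≗ t′)   = TermVarsIn V t × TermVarsIn V t′
QFVarsIn V (neg φ)    = QFVarsIn V φ
QFVarsIn V (and φ ψ)  = QFVarsIn V φ × QFVarsIn V ψ
QFVarsIn V (or φ ψ)   = QFVarsIn V φ × QFVarsIn V ψ
QFVarsIn V (impl φ ψ) = QFVarsIn V φ × QFVarsIn V ψ

VarsIn : {S : Signature} → List ℕ → UniversalFormula S → Set
VarsIn V (qf φ)    = QFVarsIn V φ
VarsIn V (all x φ) = (x ∈ˡ V) × VarsIn V φ

FinitelyManyVariables : {S : Signature} {s : Level} →
                        Pred (UniversalFormula S) s → Set s
FinitelyManyVariables Γ = ∃[ V ] (∀ φ → φ ∈ Γ → VarsIn V φ)

------------------------------------------------------------------------
-- The signatures of quasi-polyadic (equality) algebras of dimension ω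

data QAOp : Set where
  bot top compl join meet : QAOp
  cyl                     : ℕ → QAOp
  repl transp             : ℕ → ℕ → QAOp

data QEAOp : Set where
  qa   : QAOp → QEAOp
  diag : ℕ → ℕ → QEAOp

QA : Signature
QA = record
  { Op    = QAOp
  ; arity = λ where
      bot          → 0
      top          → 0
      compl        → 1
      join         → 2
      meet         → 2
      (cyl _)      → 1
      (repl _ _)   → 1
      (transp _ _) → 1
  }

QEA : Signature
QEA = record
  { Op    = QEAOp
  ; arity = λ where
      (qa f)     → arity QA f
      (diag _ _) → 0
  }

Rd : {c ℓ : Level} → Algebra QEA c ℓ → Algebra QA c ℓ
Rd A = record
  { setoid  = Algebra.setoid A
  ; op      = λ f → Algebra.op A (qa f)
  ; op-cong = λ f → Algebra.op-cong A (qa f)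
  }

------------------------------------------------------------------------
-- Set algebras and representability

-- The transformation of ω sending i to j and fixing everything else.
[_/_] : ℕ → ℕ → (ℕ → ℕ)
[ i / j ] k = if does (i ≟ k) then j else k

-- The transformation of ω interchanging i and j.
[_,_] : ℕ → ℕ → (ℕ → ℕ)
[ i , j ] k = if does (i ≟ k) then j else (if does (j ≟ k) then i else k)

module _ {u : Level} (B : Set u) where

  -- Sets of ω-sequences over the base B.
  private
    ℘ : Set (lsuc u)
    ℘ = Pred (ℕ → B) u

  -- C i X = { s : s(i/b) ∈ X for some b },  Sub τ X = { s : s ∘ τ ∈ X },
  -- D i j = { s : sᵢ = sⱼ }.
  C : ℕ → ℘ → ℘
  C i X s = ∃[ b ] ((s [ i ≔ b ]) ∈ X)

  Sub : (ℕ → ℕ) → ℘ → ℘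
  Sub τ X = (_∘ τ) ⊢ X

  D : ℕ → ℕ → ℘
  D i j s = s i ≡ s j

  private
    qaOp : (f : QAOp) → (Fin (arity QA f) → ℘) → ℘
    qaOp bot          X = ∅
    qaOp top          X = U
    qaOp compl        X = ∁ (X zero)
    qaOp join         X = X zero ∪ X (suc zero)
    qaOp meet         X = X zero ∩ X (suc zero)
    qaOp (cyl i)      X = C i (X zero)
    qaOp (repl i j)   X = Sub [ i / j ] (X zero)
    qaOp (transp i j) X = Sub [ i , j ] (X zero)

    qeaOp : (f : QEAOp) → (Fin (arity QEA f) → ℘) → ℘
    qeaOp (qa f)     X = qaOp f X
    qeaOp (diag i j) X = D i j

    qaOp-cong : (f : QAOp) {X Y : Fin (arity QA f) → ℘} →
                (∀ i → X i ≐ Y i) → qaOp f X ≐ qaOp f Y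
    qaOp-cong bot          p = (λ z → z) , (λ z → z)
    qaOp-cong top          p = (λ z → z) , (λ z → z)
    qaOp-cong compl        p = (λ n y → n (proj₂ (p zero) y))
                             , (λ n x → n (proj₁ (p zero) x))
    qaOp-cong join         p = map (proj₁ (p zero)) (proj₁ (p (suc zero)))
                             , map (proj₂ (p zero)) (proj₂ (p (suc zero)))
    qaOp-cong meet         p =
        (λ (x , y) → proj₁ (p zero) x , proj₁ (p (suc zero)) y)
      , (λ (x , y) → proj₂ (p zero) x , proj₂ (p (suc zero)) y)
    qaOp-cong (cyl i)      p = (λ (b , x) → b , proj₁ (p zero) x)
                             , (λ (b , x) → b , proj₂ (p zero) x)
    qaOp-cong (repl i j)   p = (λ x → proj₁ (p zero) x) , (λ x → proj₂ (p zero) x)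
    qaOp-cong (transp i j) p = (λ x → proj₁ (p zero) x) , (λ x → proj₂ (p zero) x)

    qeaOp-cong : (f : QEAOp) {X Y : Fin (arity QEA f) → ℘} →
                 (∀ i → X i ≐ Y i) → qeaOp f X ≐ qeaOp f Y
    qeaOp-cong (qa f)     p = qaOp-cong f p
    qeaOp-cong (diag i j) p = (λ z → z) , (λ z → z)

  FullSetQEA : Algebra QEA (lsuc u) u
  FullSetQEA = record
    { setoid  = ≐-setoid (ℕ → B) u
    ; op      = qeaOp
    ; op-cong = qeaOp-cong
    }

  FullSetQA : Algebra QA (lsuc u) u
  FullSetQA = Rd FullSetQEA

-- Representable: isomorphic to a subalgebra of a product of full set
-- algebras.  The levels κ and u bound the index set and the bases.
RQEA : (κ u : Level) {c ℓ : Level} →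
       Pred (Algebra QEA c ℓ) (c ⊔ ℓ ⊔ lsuc κ ⊔ lsuc u)
RQEA κ u A = Σ[ K ∈ Set κ ] Σ[ B ∈ (K → Set u) ]
             Embedding A (Product K (λ k → FullSetQEA (B k)))

RQA : (κ u : Level) {c ℓ : Level} →
      Pred (Algebra QA c ℓ) (c ⊔ ℓ ⊔ lsuc κ ⊔ lsuc u)
RQA κ u A = Σ[ K ∈ Set κ ] Σ[ B ∈ (K → Set u) ]
            Embedding A (Product K (λ k → FullSetQA (B k)))

{-# OPTIONS --safe #-}

-- The base consists of classes U₀, U₁, … of 2^m points each, together with
-- elements coding pairs of classes.  Let T be the set of sequences that meet
-- every class exactly once and eventually run through fixed points of U₀, U₁, ….
-- It is a single orbit of the group of finitary permutations of the base that
-- respect the classes.  Split T abstractly into parts T_j with c_i T_j = c_i T.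
--
-- If there are at most 2^m parts, the algebra is representable: label the points
-- of a class by the group (ℤ/2)^m and let T_j be the enumerations with label sum
-- j; the sum does not change under transpositions, and takes all values when one
-- entry varies in its class.  With more than 2^m parts it is not: for s ∈ T the
-- u_j with s(0/u_j) ∈ T_j are distinct, but all lie in the class missed by
-- s₁, s₂, ….  To say this with ω coordinates one uses the element Z coding the
-- two classes missed by s₂, s₃, …: the points u_j and s₁ belong to classes of Z
-- and no u_j is in the class of s₁.  The bound needs equality; without diagonals
-- the classes can be enlarged, so the reduct is always representable.
--
-- As T is a single orbit, even under permutations of the coordinates, k elements
-- distinguish at most 2^k parts.  For k ≤ m and more than 2^m parts they thus
-- generate a representable subalgebra, so the algebra satisfies every universal
-- formula in k variables that is valid in RQEA.

module Submission where

open import Defs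
open import Axiom.ExcludedMiddle using (ExcludedMiddle)
open import Axiom.Extensionality.Propositional using (Extensionality)
open import Data.Bool using (Bool; true; false; not; _∧_; _∨_; _xor_)
open import Data.Bool.Properties using (xor-assoc; xor-comm; xor-same; xor-identityˡ; ¬-not)
open import Data.Fin using (Fin; zero; suc)
open import Data.Fin.Properties using (pigeonhole; 2↔Bool; *↔×; <⇒≢)
open import Data.List using (List; length) renaming (_∷_ to _∷ˡ_)
open import Data.List.Membership.Propositional using () renaming (_∈_ to _∈ˡ_)
open import Data.List.Relation.Unary.Any using (here; there)
open import Data.Nat using (ℕ; zero; suc; _+_; _∸_; _^_; _≤_; _<_; _≟_) renaming (_⊔_ to _⊔ℕ_)
open import Data.Nat.Properties using (≤-refl; ≤-trans; m<1+n⇒m<n∨m≡n; m≤m⊔n; m≤n⊔m; m∸n+n≡m; m≤n+m; n<1+n; ^-monoʳ-<) renaming (<⇒≢ to <⇒≢ℕ)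
open import Data.Product using (Σ-syntax; ∃-syntax; _×_; _,_; proj₁; proj₂) renaming (map to ×-map; map₁ to ×-map₁)
open import Data.Product.Function.NonDependent.Propositional using (_×-↔_)
open import Data.Sum using (_⊎_; inj₁; inj₂) renaming (map to ⊎-map)
open import Data.Unit.Polymorphic using (⊤)
open import Data.Vec using (Vec; []; _∷_; zipWith; replicate; fromList; uncons) renaming (map to Vec-map)
open import Data.Vec.Properties using (zipWith-assoc; zipWith-comm; zipWith-identityˡ; ∷-injective)
open import Function using (_∘_; id; _⇔_; mk⇔; _↔_; mk↔ₛ′; Equivalence; Inverse; Injection)
open import Function.Properties.Inverse using (↔-sym; ↔-trans; ↔⇒↣)
open import Level using (Level; Lift; lift; lower)
open import Relation.Binary using (IsEquivalence)
open import Relation.Binary.PropositionalEquality using (_≡_; _≢_; refl; sym; trans; cong; cong₂; subst; subst₂; module ≡-Reasoning)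
open import Relation.Nullary using (¬_; Dec; yes; no; does; contradiction)
open import Relation.Nullary.Decidable using (dec-true; dec-false; does-⇔)
open import Relation.Unary using (Pred; _∈_)

private
  variable
    a b : Level
    A : Set a
    B : Set b
    l m : ℕ

-- Updated sequences

≔-same : (s : ℕ → A) (i : ℕ) (x : A) → (s [ i ≔ x ]) i ≡ x
≔-same s i x rewrite dec-true (i ≟ i) refl = refl

≔-other : (s : ℕ → A) (i : ℕ) (x : A) {k : ℕ} → i ≢ k → (s [ i ≔ x ]) k ≡ s k
≔-other s i x {k} i≢k rewrite dec-false (i ≟ k) i≢k = refl

≔-idem : (s : ℕ → A) (i : ℕ) (x y : A) (k : ℕ) →
         ((s [ i ≔ x ]) [ i ≔ y ]) k ≡ (s [ i ≔ y ]) k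
≔-idem s i x y k with does (i ≟ k)
... | true  = refl
... | false = refl

≔-self : (s : ℕ → A) (i k : ℕ) → (s [ i ≔ s i ]) k ≡ s k
≔-self s i k with i ≟ k
... | yes refl = ≔-same s i (s i)
... | no  i≢k  = ≔-other s i (s i) i≢k

≔-comm : (s : ℕ → A) {i j : ℕ} (x y : A) → i ≢ j → (k : ℕ) →
         ((s [ i ≔ x ]) [ j ≔ y ]) k ≡ ((s [ j ≔ y ]) [ i ≔ x ]) k
≔-comm s {i} {j} x y i≢j k with i ≟ k
... | yes refl rewrite dec-false (j ≟ i) (i≢j ∘ sym) | dec-true (i ≟ i) refl = refl
... | no  i≢k  rewrite dec-false (i ≟ k) i≢k = refl

≔-map : (f : A → B) (s : ℕ → A) (i : ℕ) (x : A) (k : ℕ) →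
        f ((s [ i ≔ x ]) k) ≡ ((f ∘ s) [ i ≔ f x ]) k
≔-map f s i x k with does (i ≟ k)
... | true  = refl
... | false = refl

[/]-refl : ∀ i k → [ i / i ] k ≡ k
[/]-refl i k with i ≟ k
... | yes refl rewrite dec-true (i ≟ i) refl = refl
... | no  i≢k  rewrite dec-false (i ≟ k) i≢k = refl

[,]-refl : ∀ i k → [ i , i ] k ≡ k
[,]-refl i k with i ≟ k
... | yes refl rewrite dec-true (i ≟ i) refl = refl
... | no  i≢k  rewrite dec-false (i ≟ k) i≢k = refl

[,]-involutive : ∀ i j k → [ i , j ] ([ i , j ] k) ≡ k
[,]-involutive i j k with i ≟ k | j ≟ k
... | yes refl | yes refl rewrite dec-true (i ≟ i) refl | dec-true (i ≟ i) refl = refl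
... | yes refl | no j≢i
  rewrite dec-true (i ≟ i) refl | dec-false (i ≟ j) (j≢i ∘ sym) | dec-true (j ≟ j) refl = refl
... | no i≢j | yes refl
  rewrite dec-false (i ≟ j) i≢j | dec-true (j ≟ j) refl | dec-true (i ≟ i) refl = refl
... | no i≢k | no j≢k
  rewrite dec-false (i ≟ k) i≢k | dec-false (j ≟ k) j≢k
        | dec-false (i ≟ k) i≢k | dec-false (j ≟ k) j≢k = refl

[,]-fixes : ∀ {i j k} → i < k → j < k → [ i , j ] k ≡ k
[,]-fixes {i} {j} {k} i<k j<k
  rewrite dec-false (i ≟ k) (<⇒≢ℕ i<k) | dec-false (j ≟ k) (<⇒≢ℕ j<k) = refl

∘[,]≗≔≔ : (s : ℕ → A) {i j : ℕ} → i ≢ j → ∀ k →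
          s ([ i , j ] k) ≡ ((s [ i ≔ s j ]) [ j ≔ s i ]) k
∘[,]≗≔≔ s {i} {j} i≢j k with i ≟ k
... | yes refl rewrite dec-false (j ≟ i) (i≢j ∘ sym) | dec-true (i ≟ i) refl = refl
... | no  i≢k  rewrite dec-false (i ≟ k) i≢k with does (j ≟ k)
...   | true  = refl
...   | false = refl

-- Labels: the elementary abelian 2-groups

Label : ℕ → Set
Label l = Vec Bool l

infixr 6 _⊕_

_⊕_ : Label l → Label l → Label l
_⊕_ = zipWith _xor_

𝟘 : Label l
𝟘 = replicate _ false

⊕-assoc : (x y z : Label l) → (x ⊕ y) ⊕ z ≡ x ⊕ (y ⊕ z)
⊕-assoc = zipWith-assoc xor-assoc

⊕-comm : (x y : Label l) → x ⊕ y ≡ y ⊕ x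
⊕-comm = zipWith-comm xor-comm

⊕-identityˡ : (x : Label l) → 𝟘 ⊕ x ≡ x
⊕-identityˡ = zipWith-identityˡ xor-identityˡ

⊕-self : (x : Label l) → x ⊕ x ≡ 𝟘
⊕-self []      = refl
⊕-self (b ∷ x) = cong₂ _∷_ (xor-same b) (⊕-self x)

⊕-cancel : (x y : Label l) → x ⊕ (x ⊕ y) ≡ y
⊕-cancel x y = trans (sym (⊕-assoc x x y)) (trans (cong (_⊕ y) (⊕-self x)) (⊕-identityˡ y))

⊕-left-comm : (x y z : Label l) → x ⊕ (y ⊕ z) ≡ y ⊕ (x ⊕ z)
⊕-left-comm x y z =
  trans (sym (⊕-assoc x y z)) (trans (cong (_⊕ z) (⊕-comm x y)) (⊕-assoc y x z))

⊕-difference : (x y : Label l) → x ≡ (x ⊕ y) ⊕ y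
⊕-difference x y =
  sym (trans (⊕-comm (x ⊕ y) y) (trans (cong (y ⊕_) (⊕-comm x y)) (⊕-cancel y x)))

label↔ : ∀ n → Label n ↔ Fin (2 ^ n)
label↔ zero    = mk↔ₛ′ (λ _ → zero) (λ _ → []) (λ { zero → refl }) (λ { [] → refl })
label↔ (suc n) = ↔-trans (mk↔ₛ′ uncons (λ (b , x) → b ∷ x) (λ _ → refl) (λ { (_ ∷ _) → refl }))
                         (↔-trans (↔-sym 2↔Bool ×-↔ label↔ n) (↔-sym *↔×))

no-label-injection : (f : Label (suc m) → Label m) → ¬ (∀ {x y} → f x ≡ f y → x ≡ y)
no-label-injection {m} f f-injective
  with pigeonhole (^-monoʳ-< 2 ≤-refl (n<1+n m)) (Inverse.to (label↔ m) ∘ f ∘ Inverse.from (label↔ (suc m)))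
... | i , j , i<j , eq = contradiction
  (Injection.injective (↔⇒↣ (↔-sym (label↔ (suc m)))) (f-injective (Injection.injective (↔⇒↣ (label↔ m)) eq)))
  (<⇒≢ i<j)

-- Finite sums of labels

VanishesFrom : ℕ → (ℕ → Label l) → Set
VanishesFrom N f = ∀ i → N ≤ i → f i ≡ 𝟘

EventuallyZero : (ℕ → Label l) → Set
EventuallyZero f = ∃[ N ] VanishesFrom N f

sumBelow : ℕ → (ℕ → Label l) → Label l
sumBelow zero    f = 𝟘
sumBelow (suc N) f = f N ⊕ sumBelow N f

sumBelow-cong : ∀ N {f g : ℕ → Label l} → (∀ {i} → i < N → f i ≡ g i) →
                sumBelow N f ≡ sumBelow N g
sumBelow-cong zero    f≗g = refl
sumBelow-cong (suc N) f≗g =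
  cong₂ _⊕_ (f≗g ≤-refl) (sumBelow-cong N λ i<N → f≗g (≤-trans i<N (m≤n+m N 1)))

-- Both the symmetry of sums and the free choice of a sum through one entry rest on splitting off a
-- single term.
sumBelow-update : ∀ N (f : ℕ → Label l) {i} x → i < N →
                  sumBelow N (f [ i ≔ x ]) ≡ x ⊕ sumBelow N (f [ i ≔ 𝟘 ])
sumBelow-update (suc N) f {i} x i<1+N with m<1+n⇒m<n∨m≡n i<1+N
... | inj₁ i<N = begin
  (f [ i ≔ x ]) N ⊕ sumBelow N (f [ i ≔ x ])         ≡⟨ cong₂ _⊕_ N-unchanged (sumBelow-update N f x i<N) ⟩
  (f [ i ≔ 𝟘 ]) N ⊕ (x ⊕ sumBelow N (f [ i ≔ 𝟘 ]))   ≡⟨ ⊕-left-comm _ x _ ⟩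
  x ⊕ ((f [ i ≔ 𝟘 ]) N ⊕ sumBelow N (f [ i ≔ 𝟘 ]))   ∎
  where
  open ≡-Reasoning
  N-unchanged : (f [ i ≔ x ]) N ≡ (f [ i ≔ 𝟘 ]) N
  N-unchanged = trans (≔-other f i x (<⇒≢ℕ i<N)) (sym (≔-other f i 𝟘 (<⇒≢ℕ i<N)))
... | inj₂ refl = begin
  (f [ i ≔ x ]) i ⊕ sumBelow i (f [ i ≔ x ])         ≡⟨ cong₂ _⊕_ (≔-same f i x) (sumBelow-cong i below-unchanged) ⟩
  x ⊕ sumBelow i (f [ i ≔ 𝟘 ])                       ≡⟨ cong (x ⊕_) (⊕-identityˡ _) ⟨
  x ⊕ (𝟘 ⊕ sumBelow i (f [ i ≔ 𝟘 ]))                 ≡⟨ cong (λ y → x ⊕ (y ⊕ sumBelow i (f [ i ≔ 𝟘 ]))) (≔-same f i 𝟘) ⟨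
  x ⊕ ((f [ i ≔ 𝟘 ]) i ⊕ sumBelow i (f [ i ≔ 𝟘 ]))   ∎
  where
  open ≡-Reasoning
  below-unchanged : ∀ {k} → k < i → (f [ i ≔ x ]) k ≡ (f [ i ≔ 𝟘 ]) k
  below-unchanged k<i =
    trans (≔-other f i x (<⇒≢ℕ k<i ∘ sym)) (sym (≔-other f i 𝟘 (<⇒≢ℕ k<i ∘ sym)))

sumBelow-extend : ∀ d {N} {f : ℕ → Label l} → VanishesFrom N f →
                  sumBelow (d + N) f ≡ sumBelow N f
sumBelow-extend zero        f≈0 = refl
sumBelow-extend (suc d) {N} {f} f≈0 =
  trans (cong (_⊕ sumBelow (d + N) f) (f≈0 (d + N) (m≤n+m N d)))
        (trans (⊕-identityˡ _) (sumBelow-extend d f≈0))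

sumBelow-≤ : ∀ {N N′} {f : ℕ → Label l} → VanishesFrom N f → N ≤ N′ →
             sumBelow N′ f ≡ sumBelow N f
sumBelow-≤ {N = N} {N′} {f} f≈0 N≤N′ =
  subst (λ n → sumBelow n f ≡ sumBelow N f) (m∸n+n≡m N≤N′) (sumBelow-extend (N′ ∸ N) f≈0)

update-vanishes : ∀ {N} {f : ℕ → Label l} i x → VanishesFrom N f →
                  VanishesFrom (N ⊔ℕ suc i) (f [ i ≔ x ])
update-vanishes {N = N} {f} i x f≈0 k le =
  trans (≔-other f i x (<⇒≢ℕ (≤-trans (m≤n⊔m N (suc i)) le)))
        (f≈0 k (≤-trans (m≤m⊔n N (suc i)) le))

update-eventuallyZero : ∀ {f : ℕ → Label l} i x → EventuallyZero f → EventuallyZero (f [ i ≔ x ])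
update-eventuallyZero i x (N , f≈0) = N ⊔ℕ suc i , update-vanishes i x f≈0

-- Points and motions

-- pt n x is the point with label x in the n-th class; pr n n′ is an auxiliary
-- element of the base, coding a pair of classes.
data Base (X : Set) : Set where
  pt : ℕ → X → Base X
  pr : ℕ → ℕ → Base X

pt-injective : {X : Set} {n n′ : ℕ} {x x′ : X} → pt n x ≡ pt n′ x′ → n ≡ n′ × x ≡ x′
pt-injective refl = refl , refl

pr-injective : {X : Set} {n n′ k k′ : ℕ} → pr {X} n n′ ≡ pr k k′ → n ≡ k × n′ ≡ k′
pr-injective refl = refl , refl

-- The sequences that meet every class exactly once and are eventually standard.
record Enumeration {m : ℕ} (s : ℕ → Base (Label m)) : Set where
  field
    class     : ℕ → ℕ
    position  : ℕ → ℕ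
    label     : ℕ → Label m
    point     : ∀ i → s i ≡ pt (class i) (label i)
    position-class : ∀ i → position (class i) ≡ i
    class-position : ∀ n → class (position n) ≡ n
    bound     : ℕ
    class-tail : ∀ i → bound ≤ i → class i ≡ i
    label-tail : VanishesFrom bound label

  class-injective : ∀ {i j} → class i ≡ class j → i ≡ j
  class-injective {i} {j} eq = trans (sym (position-class i)) (trans (cong position eq) (position-class j))

-- A group of class-respecting permutations of the base: `fwd` permutes the classes, and the labels
-- of class `n` are translated by `shift n`. The tail conditions keep enumerations eventually
-- standard.
record Motion (m : ℕ) : Set where
  field
    fwd bwd : ℕ → ℕ
    shift   : ℕ → Label m
    bwd-fwd : ∀ n → bwd (fwd n) ≡ n
    fwd-bwd : ∀ n → fwd (bwd n) ≡ n
    bound   : ℕ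
    fwd-tail : ∀ n → bound ≤ n → fwd n ≡ n
    shift-tail : VanishesFrom bound shift

  fwd-injective : ∀ {i j} → fwd i ≡ fwd j → i ≡ j
  fwd-injective {i} {j} eq = trans (sym (bwd-fwd i)) (trans (cong bwd eq) (bwd-fwd j))

  bwd-tail : ∀ n → bound ≤ n → bwd n ≡ n
  bwd-tail n le = trans (cong bwd (sym (fwd-tail n le))) (bwd-fwd n)

-- A code moves along with the two classes it codes, which makes `Among` and `missed` invariant.
act : Motion m → Base (Label m) → Base (Label m)
act g (pt n x)  = pt (Motion.fwd g n) (Motion.shift g n ⊕ x)
act g (pr n n′) = pr (Motion.fwd g n) (Motion.fwd g n′)

infix 8 _⁻¹

_⁻¹ : Motion m → Motion m
g ⁻¹ = record
  { fwd        = bwd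
  ; bwd        = fwd
  -- Translations are their own inverses, so a class only needs the translation of the class it came
  -- from.
  ; shift      = shift ∘ bwd
  ; bwd-fwd    = fwd-bwd
  ; fwd-bwd    = bwd-fwd
  ; bound      = bound
  ; fwd-tail   = bwd-tail
  ; shift-tail = λ n le → trans (cong shift (bwd-tail n le)) (shift-tail n le)
  } where open Motion g

act-inverseˡ : (g : Motion m) (p : Base (Label m)) → act (g ⁻¹) (act g p) ≡ p
act-inverseˡ g (pt n x) = cong₂ pt (bwd-fwd n)
  (trans (cong (λ k → shift k ⊕ shift n ⊕ x) (bwd-fwd n)) (⊕-cancel (shift n) x))
  where open Motion g
act-inverseˡ g (pr n n′) = cong₂ pr (bwd-fwd n) (bwd-fwd n′)
  where open Motion g

act-inverseʳ : (g : Motion m) (p : Base (Label m)) → act g (act (g ⁻¹) p) ≡ p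
act-inverseʳ g (pt n x) = cong₂ pt (fwd-bwd n) (⊕-cancel (shift (bwd n)) x)
  where open Motion g
act-inverseʳ g (pr n n′) = cong₂ pr (fwd-bwd n) (fwd-bwd n′)
  where open Motion g

act-injective : (g : Motion m) {p p′ : Base (Label m)} → act g p ≡ act g p′ → p ≡ p′
act-injective g {p} {p′} eq =
  trans (sym (act-inverseˡ g p)) (trans (cong (act (g ⁻¹)) eq) (act-inverseˡ g p′))

standard : ℕ → Base (Label m)
standard i = pt i 𝟘

standard-enumeration : Enumeration {m} standard
standard-enumeration = record
  { class          = λ i → i
  ; position       = λ i → i
  ; label          = λ _ → 𝟘
  ; point          = λ _ → refl
  ; position-class = λ _ → refl
  ; class-position = λ _ → refl
  ; bound          = 0
  ; class-tail     = λ _ _ → refl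
  ; label-tail     = λ _ _ → refl
  }

enumeration-act : (g : Motion m) {s : ℕ → Base (Label m)} →
                  Enumeration s → Enumeration (act g ∘ s)
enumeration-act g e = record
  { class          = fwd ∘ class
  ; position       = position ∘ bwd
  ; label          = λ i → shift (class i) ⊕ label i
  ; point          = λ i → cong (act g) (point i)
  ; position-class = λ i → trans (cong position (bwd-fwd (class i))) (position-class i)
  ; class-position = λ n → trans (cong fwd (class-position (bwd n))) (fwd-bwd n)
  ; bound          = e.bound ⊔ℕ g.bound
  ; class-tail     = λ i le → trans (cong fwd (class-tail i (e≤ le))) (fwd-tail i (g≤ le))
  ; label-tail     = λ i le → trans
      (cong₂ _⊕_ (trans (cong shift (class-tail i (e≤ le))) (shift-tail i (g≤ le)))
                 (label-tail i (e≤ le)))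
      (⊕-identityˡ 𝟘)
  }
  where
  module g = Motion g
  module e = Enumeration e
  open Motion g hiding (bound)
  open Enumeration e hiding (bound)
  e≤ : ∀ {i} → e.bound ⊔ℕ g.bound ≤ i → e.bound ≤ i
  e≤ = ≤-trans (m≤m⊔n e.bound g.bound)
  g≤ : ∀ {i} → e.bound ⊔ℕ g.bound ≤ i → g.bound ≤ i
  g≤ = ≤-trans (m≤n⊔m e.bound g.bound)

enumeration-transp : ∀ i j {s : ℕ → Base (Label m)} →
                     Enumeration s → Enumeration (s ∘ [ i , j ])
enumeration-transp i j e = record
  { class          = class ∘ [ i , j ]
  ; position       = [ i , j ] ∘ position
  ; label          = label ∘ [ i , j ]
  ; point          = λ k → point ([ i , j ] k)
  ; position-class = λ k → trans (cong [ i , j ] (position-class ([ i , j ] k))) ([,]-involutive i j k)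
  ; class-position = λ n → trans (cong class ([,]-involutive i j (position n))) (class-position n)
  ; bound          = bound ⊔ℕ (suc i ⊔ℕ suc j)
  ; class-tail     = λ k le → trans (cong class (fixed le)) (class-tail k (above le))
  ; label-tail     = λ k le → trans (cong label (fixed le)) (label-tail k (above le))
  }
  where
  open Enumeration e
  above : ∀ {k} → bound ⊔ℕ (suc i ⊔ℕ suc j) ≤ k → bound ≤ k
  above = ≤-trans (m≤m⊔n bound _)
  fixed : ∀ {k} → bound ⊔ℕ (suc i ⊔ℕ suc j) ≤ k → [ i , j ] k ≡ k
  fixed le = [,]-fixes (≤-trans (m≤m⊔n (suc i) (suc j)) rest) (≤-trans (m≤n⊔m (suc i) (suc j)) rest)
    where rest = ≤-trans (m≤n⊔m bound _) le

-- For distinct `i` and `j` the composite repeats a value and so meets a class twice. Hence only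
-- trivial replacements lead to split sequences.
enumeration-repl : ∀ i j (s : ℕ → Base (Label m)) → Enumeration (s ∘ [ i / j ]) → i ≡ j
enumeration-repl i j s e with i ≟ j
... | yes i≡j = i≡j
... | no  i≢j = Enumeration.class-injective e (proj₁ (pt-injective same-point))
  where
  open Enumeration e
  i↦j : [ i / j ] i ≡ j
  i↦j rewrite dec-true (i ≟ i) refl = refl
  j↦j : [ i / j ] j ≡ j
  j↦j rewrite dec-false (i ≟ j) i≢j = refl
  same-point : pt (class i) (label i) ≡ pt (class j) (label j)
  same-point = trans (sym (point i)) (trans (cong s (trans i↦j (sym j↦j))) (point j))

-- Classes and positions stay as they are; the bound has to pass `i`, where the new label may be
-- nonzero.
enumeration-relabel : ∀ (s : ℕ → Base (Label m)) i {n x} y →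
                      Enumeration (s [ i ≔ pt n x ]) → Enumeration (s [ i ≔ pt n y ])
enumeration-relabel s i {n} {x} y e = record
  { class          = class
  ; position       = position
  ; label          = label [ i ≔ y ]
  ; point          = relabelled
  ; position-class = position-class
  ; class-position = class-position
  ; bound          = bound ⊔ℕ suc i
  ; class-tail     = λ k le → class-tail k (≤-trans (m≤m⊔n bound (suc i)) le)
  ; label-tail     = update-vanishes i y label-tail
  }
  where
  open Enumeration e
  relabelled : ∀ k → (s [ i ≔ pt n y ]) k ≡ pt (class k) ((label [ i ≔ y ]) k)
  relabelled k with i ≟ k
  ... | yes refl = trans (≔-same s i _)
    (cong₂ pt (proj₁ (pt-injective (trans (sym (≔-same s i _)) (point i)))) (sym (≔-same label i y)))
  ... | no i≢k = trans (≔-other s i _ i≢k) (trans (sym (≔-other s i _ i≢k))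
    (trans (point k) (cong (pt (class k)) (sym (≔-other label i y i≢k)))))

-- The motion sends the class of `s i` to that of `t i` and translates by the difference of the two
-- labels, which is their sum. Beyond both bounds the sequences are standard, so the motion is
-- trivial there.
transitive : {s t : ℕ → Base (Label m)} → Enumeration s → Enumeration t →
             Σ[ g ∈ Motion m ] (∀ i → act g (s i) ≡ t i)
transitive {m} {s} {t} d e = g , moves
  where
  module d = Enumeration d
  module e = Enumeration e
  N = d.bound ⊔ℕ e.bound
  d≤ : ∀ {i} → N ≤ i → d.bound ≤ i
  d≤ = ≤-trans (m≤m⊔n d.bound e.bound)
  e≤ : ∀ {i} → N ≤ i → e.bound ≤ i
  e≤ = ≤-trans (m≤n⊔m d.bound e.bound)
  position-tail : ∀ {i} → N ≤ i → d.position i ≡ i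
  position-tail {i} le = trans (cong d.position (sym (d.class-tail i (d≤ le)))) (d.position-class i)
  g : Motion m
  g = record
    { fwd        = e.class ∘ d.position
    ; bwd        = d.class ∘ e.position
    ; shift      = λ n → d.label (d.position n) ⊕ e.label (d.position n)
    ; bwd-fwd    = λ n → trans (cong d.class (e.position-class _)) (d.class-position n)
    ; fwd-bwd    = λ n → trans (cong e.class (d.position-class _)) (e.class-position n)
    ; bound      = N
    ; fwd-tail   = λ n le → trans (cong e.class (position-tail le)) (e.class-tail n (e≤ le))
    ; shift-tail = λ n le → trans
        (cong₂ _⊕_ (trans (cong d.label (position-tail le)) (d.label-tail n (d≤ le)))
                   (trans (cong e.label (position-tail le)) (e.label-tail n (e≤ le))))
        (⊕-identityˡ 𝟘)
    }
  moves : ∀ i → act g (s i) ≡ t i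
  moves i = trans (cong (act g) (d.point i)) (trans (cong₂ pt
    (cong e.class (d.position-class i))
    (trans (cong (λ k → (d.label k ⊕ e.label k) ⊕ d.label i) (d.position-class i))
           (trans (⊕-comm _ _) (⊕-cancel (d.label i) (e.label i)))))
    (sym (e.point i)))

-- Preservation of quantifier-free formulas

module _ {S : Signature} {c₁ ℓ₁ c₂ ℓ₂ : Level} {A : Algebra S c₁ ℓ₁} {B : Algebra S c₂ ℓ₂}
         (ι : Embedding A B) (V : List ℕ)
         {v : ℕ → Algebra.Carrier A} {w : ℕ → Algebra.Carrier B}
         (agree : ∀ {x} → x ∈ˡ V → Algebra._≈_ B (Embedding.to ι (v x)) (w x)) where

  private
    module A = Algebra A
    module B = Algebra B
    module ⟦A⟧ = Semantics A
    module ⟦B⟧ = Semantics B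
    open Embedding ι
    open IsEquivalence B.isEquivalence renaming (sym to ≈-sym; trans to ≈-trans) using ()

  term-preserved : ∀ t → TermVarsIn V t → to (⟦A⟧.⟦ t ⟧ v) B.≈ ⟦B⟧.⟦ t ⟧ w
  term-preserved (var x)    x∈V = agree x∈V
  term-preserved (app f ts) ts∈V =
    ≈-trans (homo f _) (B.op-cong f (λ i → term-preserved (ts i) (ts∈V i)))

  -- Embeddings preserve and also reflect equations, so the equivalence passes through negations and
  -- implications.
  qf-preserved : ∀ φ → QFVarsIn V φ → ⟦A⟧.HoldsQF φ v ⇔ ⟦B⟧.HoldsQF φ w
  qf-preserved (t ≗ t′) (t∈V , t′∈V) = mk⇔
    (λ eq → ≈-trans (≈-sym (term-preserved t t∈V)) (≈-trans (congruent eq) (term-preserved t′ t′∈V)))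
    (λ eq → injective (≈-trans (term-preserved t t∈V) (≈-trans eq (≈-sym (term-preserved t′ t′∈V)))))
  qf-preserved (neg φ) φ∈V = mk⇔ (_∘ from) (_∘ to′)
    where open Equivalence (qf-preserved φ φ∈V) renaming (to to to′)
  qf-preserved (and φ ψ) (φ∈V , ψ∈V) = mk⇔ (×-map φ.to ψ.to) (×-map φ.from ψ.from)
    where module φ = Equivalence (qf-preserved φ φ∈V)
          module ψ = Equivalence (qf-preserved ψ ψ∈V)
  qf-preserved (or φ ψ) (φ∈V , ψ∈V) = mk⇔ (⊎-map φ.to ψ.to) (⊎-map φ.from ψ.from)
    where module φ = Equivalence (qf-preserved φ φ∈V)
          module ψ = Equivalence (qf-preserved ψ ψ∈V)
  qf-preserved (impl φ ψ) (φ∈V , ψ∈V) = mk⇔ (λ h → ψ.to ∘ h ∘ φ.from) (λ h → ψ.from ∘ h ∘ φ.to)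
    where module φ = Equivalence (qf-preserved φ φ∈V)
          module ψ = Equivalence (qf-preserved ψ ψ∈V)

matrix : {S : Signature} → UniversalFormula S → QuantifierFree S
matrix (qf φ)    = φ
matrix (all _ φ) = matrix φ

matrix-vars : {S : Signature} {V : List ℕ} (φ : UniversalFormula S) → VarsIn V φ → QFVarsIn V (matrix φ)
matrix-vars (qf φ)    φ∈V       = φ∈V
matrix-vars (all _ φ) (_ , φ∈V) = matrix-vars φ φ∈V

module _ {S : Signature} {c ℓ : Level} (A : Algebra S c ℓ) where
  open Algebra A
  open Semantics A

  -- Each quantifier is instantiated by the present value of its variable, which leaves the
  -- valuation unchanged.
  matrix-holds : (∀ {a b} → Extensionality a b) →
                 ∀ φ v → Holds φ v → HoldsQF (matrix φ) v
  matrix-holds ext (qf φ)    v (lift h) = h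
  matrix-holds ext (all x φ) v h        =
    matrix-holds ext φ v (subst (Holds φ) (ext (≔-self v x)) (h (v x)))

  holds-from-matrix : ∀ φ → (∀ v → HoldsQF (matrix φ) v) → ∀ v → Holds φ v
  holds-from-matrix (qf φ)    h v   = lift (h v)
  holds-from-matrix (all x φ) h v a = holds-from-matrix φ h (v [ x ≔ a ])

-- Boolean truth values

bool-ext : ∀ {x y : Bool} → (x ≡ true → y ≡ true) → (y ≡ true → x ≡ true) → x ≡ y
bool-ext {true}  {y}     f g = sym (f refl)
bool-ext {false} {false} f g = refl
bool-ext {false} {true}  f g = g refl

does-witness : {P : Set a} (d : Dec P) → does d ≡ true → P
does-witness (yes p) _ = p

∨-elim : ∀ x y → x ∨ y ≡ true → x ≡ true ⊎ y ≡ true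
∨-elim true  y _ = inj₁ refl
∨-elim false y e = inj₂ e

∨-introˡ : ∀ {x y} → x ≡ true → x ∨ y ≡ true
∨-introˡ refl = refl

∨-introʳ : ∀ x {y} → y ≡ true → x ∨ y ≡ true
∨-introʳ true  _ = refl
∨-introʳ false e = e

∧-elim : ∀ x y → x ∧ y ≡ true → x ≡ true × y ≡ true
∧-elim true y e = refl , e

module Classical (em : ∀ {a} → ExcludedMiddle a) (ext : ∀ {a b} → Extensionality a b) where

  ≡-from-2 : {s t : ℕ → A} → s 0 ≡ t 0 → s 1 ≡ t 1 → (∀ n → s (2 + n) ≡ t (2 + n)) → s ≡ t
  ≡-from-2 e₀ e₁ e = ext λ { 0 → e₀ ; 1 → e₁ ; (suc (suc n)) → e n }

  ≡-from-4 : {s t : ℕ → A} → s 0 ≡ t 0 → s 1 ≡ t 1 → s 2 ≡ t 2 → s 3 ≡ t 3 →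
             (∀ n → s (4 + n) ≡ t (4 + n)) → s ≡ t
  ≡-from-4 e₀ e₁ e₂ e₃ e = ≡-from-2 e₀ e₁ λ { 0 → e₂ ; 1 → e₃ ; (suc (suc n)) → e n }

  opaque
    -- With Boolean-valued membership the elements of the algebras form a `Set`, which lifts to
    -- every level `c`.
    truth : Set → Bool
    truth P = does (em {P = P})

    truth-intro : {P : Set} → P → truth P ≡ true
    truth-intro = dec-true em

    truth-elim : {P : Set} → truth P ≡ true → P
    truth-elim = does-witness em

    truth-⇔ : {P Q : Set} → (P → Q) → (Q → P) → truth P ≡ truth Q
    truth-⇔ f g = does-⇔ (mk⇔ f g) em em

  -- Junk value 𝟘 when f is not eventually zero.
  total : (ℕ → Label l) → Label l
  total f with em {P = EventuallyZero f}
  ... | yes (N , _) = sumBelow N f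
  ... | no  _       = 𝟘

  total-sumBelow : ∀ {N} {f : ℕ → Label l} → VanishesFrom N f → total f ≡ sumBelow N f
  total-sumBelow {N = N} {f} f≈0 with em {P = EventuallyZero f}
  ... | yes (N′ , f≈0′) = trans (sym (sumBelow-≤ f≈0′ (m≤n⊔m N N′))) (sumBelow-≤ f≈0 (m≤m⊔n N N′))
  ... | no  ¬f≈0        = contradiction (N , f≈0) ¬f≈0

  total-update : ∀ {f : ℕ → Label l} i x → EventuallyZero f →
                 total (f [ i ≔ x ]) ≡ x ⊕ total (f [ i ≔ 𝟘 ])
  total-update {f = f} i x (N , f≈0) = begin
    total (f [ i ≔ x ])                        ≡⟨ total-sumBelow (update-vanishes i x f≈0) ⟩
    sumBelow (N ⊔ℕ suc i) (f [ i ≔ x ])        ≡⟨ sumBelow-update _ f x (m≤n⊔m N (suc i)) ⟩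
    x ⊕ sumBelow (N ⊔ℕ suc i) (f [ i ≔ 𝟘 ])    ≡⟨ cong (x ⊕_) (total-sumBelow (update-vanishes i 𝟘 f≈0)) ⟨
    x ⊕ total (f [ i ≔ 𝟘 ])                    ∎
    where open ≡-Reasoning

  -- A transposition amounts to two updates with interchanged values; both values split off the sum,
  -- where they commute.
  total-transp : ∀ {f : ℕ → Label l} i j → EventuallyZero f → total (f ∘ [ i , j ]) ≡ total f
  total-transp {f = f} i j f≈0 with i ≟ j
  ... | yes refl = cong total (ext λ k → cong f ([,]-refl i k))
  ... | no  i≢j  = begin
    total (f ∘ [ i , j ])                       ≡⟨ cong total (ext (∘[,]≗≔≔ f i≢j)) ⟩
    total ((f [ i ≔ f j ]) [ j ≔ f i ])         ≡⟨ total-update₂ (f j) (f i) ⟩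
    f i ⊕ f j ⊕ rest                            ≡⟨ ⊕-left-comm (f i) (f j) rest ⟩
    f j ⊕ f i ⊕ rest                            ≡⟨ total-update₂ (f i) (f j) ⟨
    total ((f [ i ≔ f i ]) [ j ≔ f j ])         ≡⟨ cong total (ext unchanged) ⟩
    total f                                     ∎
    where
    open ≡-Reasoning
    rest = total ((f [ j ≔ 𝟘 ]) [ i ≔ 𝟘 ])
    total-update₂ : ∀ x y → total ((f [ i ≔ x ]) [ j ≔ y ]) ≡ y ⊕ x ⊕ rest
    total-update₂ x y = begin
      total ((f [ i ≔ x ]) [ j ≔ y ])           ≡⟨ total-update j y (update-eventuallyZero i x f≈0) ⟩
      y ⊕ total ((f [ i ≔ x ]) [ j ≔ 𝟘 ])       ≡⟨ cong (λ h → y ⊕ total h) (ext (≔-comm f x 𝟘 i≢j)) ⟩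
      y ⊕ total ((f [ j ≔ 𝟘 ]) [ i ≔ x ])       ≡⟨ cong (y ⊕_) (total-update i x (update-eventuallyZero j 𝟘 f≈0)) ⟩
      y ⊕ x ⊕ rest                              ∎
    unchanged : ∀ k → ((f [ i ≔ f i ]) [ j ≔ f j ]) k ≡ f k
    unchanged k = trans (cong (λ h → (h [ j ≔ f j ]) k) (ext (≔-self f i))) (≔-self f j k)

  -- The algebras with split enumerations

  module _ {m : ℕ} {J : Set} where

    Seq : Set
    Seq = ℕ → Base (Label m)

    -- The point s of the set algebra is replaced by the points (s , j), j ∈ J.
    -- Admissible sets cannot tell these apart unless s is an enumeration.
    Raw : Set
    Raw = Seq → J → Bool

    rawOp : (f : QEAOp) → (Fin (arity QEA f) → Raw) → Raw
    rawOp (qa bot)          X s j = false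
    rawOp (qa top)          X s j = true
    rawOp (qa compl)        X s j = not (X zero s j)
    rawOp (qa join)         X s j = X zero s j ∨ X (suc zero) s j
    rawOp (qa meet)         X s j = X zero s j ∧ X (suc zero) s j
    -- The part may change together with the entry; this yields c_i T_j = c_i T.
    rawOp (qa (cyl i))      X s j = truth (∃[ p ] ∃[ k ] X zero (s [ i ≔ p ]) k ≡ true)
    rawOp (qa (repl i i′))   X s j = X zero (s ∘ [ i / i′ ]) j
    rawOp (qa (transp i i′)) X s j = X zero (s ∘ [ i , i′ ]) j
    rawOp (diag i i′)        X s j = truth (s i ≡ s i′)

    module _ {Y : Set} (κ : J → Y) where

      -- `κ = id` gives the full algebra; other choices of `κ` give its subalgebras in which parts
      -- of equal value are merged.
      record Admissible (F : Raw) : Set where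
        no-eta-equality
        field
          invariant : ∀ g s j → F (act g ∘ s) j ≡ F s j
          unsplit   : ∀ s → ¬ Enumeration s → ∀ j k → F s j ≡ F s k
          respects  : ∀ s {j k} → κ j ≡ κ k → F s j ≡ F s k

      open Admissible

      opaque
        -- Motions carry witnesses of cylinders along, and inverse motions bring them back. A
        -- sequence that becomes an enumeration by a substitution was one before, so nothing outside
        -- `T` gets split.
        rawOp-admissible : ∀ f {X} → (∀ i → Admissible (X i)) → Admissible (rawOp f X)
        rawOp-admissible (qa bot) X-adm = record
          { invariant = λ _ _ _ → refl ; unsplit = λ _ _ _ _ → refl ; respects = λ _ _ → refl }
        rawOp-admissible (qa top) X-adm = record
          { invariant = λ _ _ _ → refl ; unsplit = λ _ _ _ _ → refl ; respects = λ _ _ → refl }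
        rawOp-admissible (qa compl) X-adm = record
          { invariant = λ g s j → cong not (invariant (X-adm zero) g s j)
          ; unsplit   = λ s ¬e j k → cong not (unsplit (X-adm zero) s ¬e j k)
          ; respects  = λ s eq → cong not (respects (X-adm zero) s eq) }
        rawOp-admissible (qa join) X-adm = record
          { invariant = λ g s j → cong₂ _∨_ (invariant (X-adm zero) g s j) (invariant (X-adm (suc zero)) g s j)
          ; unsplit   = λ s ¬e j k → cong₂ _∨_ (unsplit (X-adm zero) s ¬e j k) (unsplit (X-adm (suc zero)) s ¬e j k)
          ; respects  = λ s eq → cong₂ _∨_ (respects (X-adm zero) s eq) (respects (X-adm (suc zero)) s eq) }
        rawOp-admissible (qa meet) X-adm = record
          { invariant = λ g s j → cong₂ _∧_ (invariant (X-adm zero) g s j) (invariant (X-adm (suc zero)) g s j)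
          ; unsplit   = λ s ¬e j k → cong₂ _∧_ (unsplit (X-adm zero) s ¬e j k) (unsplit (X-adm (suc zero)) s ¬e j k)
          ; respects  = λ s eq → cong₂ _∧_ (respects (X-adm zero) s eq) (respects (X-adm (suc zero)) s eq) }
        rawOp-admissible (qa (cyl i)) {X} X-adm = record
          { invariant = λ g s j → truth-⇔
              (λ (p , k , h) → act (g ⁻¹) p , k , trans (sym (moved g s p k)) h)
              (λ (p , k , h) → act g p , k , trans (cong (λ t → X zero t k) (sym (ext (≔-map (act g) s i p))))
                                                    (trans (invariant (X-adm zero) g (s [ i ≔ p ]) k) h))
          ; unsplit   = λ _ _ _ _ → refl
          ; respects  = λ _ _ → refl }
          where
          moved : ∀ g s p k → X zero ((act g ∘ s) [ i ≔ p ]) k ≡ X zero (s [ i ≔ act (g ⁻¹) p ]) k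
          moved g s p k = trans
            (cong (λ t → X zero t k) (ext λ n → trans
              (cong (λ p → ((act g ∘ s) [ i ≔ p ]) n) (sym (act-inverseʳ g p)))
              (sym (≔-map (act g) s i (act (g ⁻¹) p) n))))
            (invariant (X-adm zero) g (s [ i ≔ act (g ⁻¹) p ]) k)
        rawOp-admissible (qa (repl i i′)) {X} X-adm = record
          { invariant = λ g s j → invariant (X-adm zero) g (s ∘ [ i / i′ ]) j
          ; unsplit   = λ s ¬e → unsplit (X-adm zero) (s ∘ [ i / i′ ]) (¬e ∘ undo s)
          ; respects  = λ s eq → respects (X-adm zero) (s ∘ [ i / i′ ]) eq }
          where
          undo : (s : ℕ → Base (Label m)) → Enumeration (s ∘ [ i / i′ ]) → Enumeration s
          undo s e with enumeration-repl i i′ s e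
          ... | refl = subst Enumeration (ext λ k → cong s ([/]-refl i k)) e
        rawOp-admissible (qa (transp i i′)) {X} X-adm = record
          { invariant = λ g s j → invariant (X-adm zero) g (s ∘ [ i , i′ ]) j
          ; unsplit   = λ s ¬e → unsplit (X-adm zero) (s ∘ [ i , i′ ]) (¬e ∘ undo s)
          ; respects  = λ s eq → respects (X-adm zero) (s ∘ [ i , i′ ]) eq }
          where
          undo : (s : ℕ → Base (Label m)) → Enumeration (s ∘ [ i , i′ ]) → Enumeration s
          undo s e = subst Enumeration (ext λ k → cong s ([,]-involutive i i′ k)) (enumeration-transp i i′ e)
        rawOp-admissible (diag i i′) X-adm = record
          { invariant = λ g s j → truth-⇔ (act-injective g) (cong (act g))
          ; unsplit   = λ _ _ _ _ → refl
          ; respects  = λ _ _ → refl }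

      Element : Set
      Element = Σ[ F ∈ Raw ] Admissible F

      -- As the enumerations form a single orbit, an element restricted to them is just a set of
      -- parts.
      orbit : (X : Element) {s t : Seq} → Enumeration s → Enumeration t →
              ∀ j → proj₁ X s j ≡ proj₁ X t j
      orbit (F , F-adm) {s} d e j with transitive d e
      ... | g , moves = trans (sym (invariant F-adm g s j)) (cong (λ t → F t j) (ext moves))

      Split : (c ℓ : Level) → Algebra QEA c ℓ
      Split c ℓ = record
        { setoid = record
          { Carrier       = Lift c Element
          ; _≈_           = λ (lift X) (lift Y) → Lift ℓ (∀ s j → proj₁ X s j ≡ proj₁ Y s j)
          ; isEquivalence = record
            { refl  = lift λ _ _ → refl
            ; sym   = λ (lift p) → lift λ s j → sym (p s j)
            ; trans = λ (lift p) (lift q) → lift λ s j → trans (p s j) (q s j)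
            }
          }
        ; op      = λ f X → lift ( rawOp f (λ i → proj₁ (lower (X i)))
                                 , rawOp-admissible f (λ i → proj₂ (lower (X i))))
        ; op-cong = λ f p → lift λ s j → cong (λ X → rawOp f X s j)
            (ext λ i → ext λ t → ext λ k → lower (p i) t k)
        }

    inclusion : {Y : Set} (κ : J → Y) (c ℓ : Level) → Embedding (Split κ c ℓ) (Split id c ℓ)
    inclusion κ c ℓ = record
      { to        = λ (lift (F , F-adm)) → lift (F , record
          { invariant = Admissible.invariant F-adm
          ; unsplit   = Admissible.unsplit F-adm
          ; respects  = λ s eq → cong (F s) eq })
      ; congruent = λ p → p
      ; homo      = λ f X → lift λ _ _ → refl
      ; injective = λ p → p
      }

  -- Representations by label sums

  mapBase : {X Y : Set} → (X → Y) → Base X → Base Y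
  mapBase f (pt n x)  = pt n (f x)
  mapBase f (pr n n′) = pr n n′

  mapBase-section : {X Y : Set} {f : X → Y} {h : Y → X} → (∀ y → f (h y) ≡ y) →
                    ∀ p → mapBase f (mapBase h p) ≡ p
  mapBase-section fh (pt n y)  = cong (pt n) (fh y)
  mapBase-section fh (pr n n′) = refl

  mapBase-injective : {X Y : Set} {f : X → Y} → (∀ {x x′} → f x ≡ f x′ → x ≡ x′) →
                      ∀ p p′ → mapBase f p ≡ mapBase f p′ → p ≡ p′
  mapBase-injective inj (pt n x)  (pt n′ x′) eq with pt-injective eq
  ... | n≡n′ , fx≡fx′ = cong₂ pt n≡n′ (inj fx≡fx′)
  mapBase-injective inj (pr n n′) (pr k k′) eq with pr-injective eq
  ... | n≡k , n′≡k′ = cong₂ pr n≡k n′≡k′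

  baseLabel : Base (Label l) → Label l
  baseLabel (pt n x)  = x
  baseLabel (pr n n′) = 𝟘

  -- An element X is represented by the sequences s whose projection
  -- mapBase q ∘ s lies in X, with an enumeration put into the part of X
  -- numbered by the sum of its labels.  Relabelling one entry of an
  -- enumeration produces every sum, so that cylindrifications see all parts.
  module Representation {m l : ℕ} {J : Set}
    (κ : J → Label l) (e : Label l → J) (κeκ : ∀ j → κ (e (κ j)) ≡ κ j)
    (q : Label l → Label m) (q⁻ : Label m → Label l) (qq⁻ : ∀ x → q (q⁻ x) ≡ x)
    (q-reflects-𝟘 : ∀ x → q x ≡ 𝟘 → x ≡ 𝟘)
    where

    -- By `κeκ`, the part chosen by `e` has the label sum as its `κ`-value whenever some part has.
    part : (ℕ → Base (Label l)) → J
    part s = e (total (baseLabel ∘ s))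

    represents : Element {m} κ → (ℕ → Base (Label l)) → Bool
    represents (F , _) s = F (mapBase q ∘ s) (part s)

    map-update : ∀ s i p → mapBase q ∘ (s [ i ≔ p ]) ≡ (mapBase q ∘ s) [ i ≔ mapBase q p ]
    map-update s i p = ext (≔-map (mapBase q) s i p)

    vanishing-label : ∀ p {n x} → mapBase q p ≡ pt n x → x ≡ 𝟘 → baseLabel p ≡ 𝟘
    vanishing-label (pt n x) eq x≡𝟘 = q-reflects-𝟘 x (trans (proj₂ (pt-injective eq)) x≡𝟘)

    -- The projected labels vanish from some point on, and only `𝟘` lies over `𝟘` under `q`; thus
    -- `total` is a genuine sum here.
    labels-eventuallyZero : ∀ s i p → Enumeration ((mapBase q ∘ s) [ i ≔ p ]) → EventuallyZero (baseLabel ∘ s)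
    labels-eventuallyZero s i p en = bound ⊔ℕ suc i , λ k le → vanishing-label (s k)
      (trans (sym (≔-other (mapBase q ∘ s) i p (<⇒≢ℕ (≤-trans (m≤n⊔m bound (suc i)) le)))) (point k))
      (label-tail k (≤-trans (m≤m⊔n bound (suc i)) le))
      where open Enumeration en

    relabel : (X : Element {m} κ) → ∀ s i n x j → Enumeration ((mapBase q ∘ s) [ i ≔ pt n x ]) →
              ∃[ y ] represents X (s [ i ≔ pt n y ]) ≡ proj₁ X ((mapBase q ∘ s) [ i ≔ pt n x ]) j
    relabel X@(F , F-adm) s i n x j en = y , (begin
      F (mapBase q ∘ (s [ i ≔ pt n y ])) (part (s [ i ≔ pt n y ]))  ≡⟨ cong₂ F (map-update s i (pt n y)) (cong e sum) ⟩
      F ((mapBase q ∘ s) [ i ≔ pt n (q y) ]) (e (κ j))              ≡⟨ orbit κ X relabelled en (e (κ j)) ⟩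
      F ((mapBase q ∘ s) [ i ≔ pt n x ]) (e (κ j))                  ≡⟨ Admissible.respects F-adm _ (κeκ j) ⟩
      F ((mapBase q ∘ s) [ i ≔ pt n x ]) j                          ∎)
      where
      open ≡-Reasoning
      labels = baseLabel ∘ s
      others = total (labels [ i ≔ 𝟘 ])
      -- In a group of exponent 2 this label completes the sum of the others to `κ j`.
      y = others ⊕ κ j
      relabelled = enumeration-relabel (mapBase q ∘ s) i (q y) en
      sum : total (baseLabel ∘ (s [ i ≔ pt n y ])) ≡ κ j
      sum = begin
        total (baseLabel ∘ (s [ i ≔ pt n y ]))  ≡⟨ cong total (ext (≔-map baseLabel s i (pt n y))) ⟩
        total (labels [ i ≔ y ])                ≡⟨ total-update i y (labels-eventuallyZero s i (pt n x) en) ⟩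
        (others ⊕ κ j) ⊕ others                 ≡⟨ ⊕-comm (others ⊕ κ j) others ⟩
        others ⊕ others ⊕ κ j                   ≡⟨ ⊕-cancel others (κ j) ⟩
        κ j                                     ∎

    -- Off the enumerations the part is invisible, so any preimage of `p` will do. For an
    -- enumeration, `p` is a point, and its label is adjusted to reach the required part.
    represents-cyl : (X : Element {m} κ) → ∀ s i p j → proj₁ X ((mapBase q ∘ s) [ i ≔ p ]) j ≡ true →
                     ∃[ p′ ] represents X (s [ i ≔ p′ ]) ≡ true
    represents-cyl X@(F , F-adm) s i p j h with em {P = Enumeration ((mapBase q ∘ s) [ i ≔ p ])}
    ... | no ¬en = mapBase q⁻ p , (begin
      F (mapBase q ∘ (s [ i ≔ mapBase q⁻ p ])) k             ≡⟨ cong (λ t → F t k) (map-update s i _) ⟩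
      F ((mapBase q ∘ s) [ i ≔ mapBase q (mapBase q⁻ p) ]) k
        ≡⟨ cong (λ p → F ((mapBase q ∘ s) [ i ≔ p ]) k) (mapBase-section qq⁻ p) ⟩
      F ((mapBase q ∘ s) [ i ≔ p ]) k                        ≡⟨ Admissible.unsplit F-adm _ ¬en k j ⟩
      F ((mapBase q ∘ s) [ i ≔ p ]) j                        ≡⟨ h ⟩
      true                                                   ∎)
      where
      open ≡-Reasoning
      k = part (s [ i ≔ mapBase q⁻ p ])
    represents-cyl X s i (pt n x) j h | yes en with relabel X s i n x j en
    ... | y , eq = pt n y , trans eq h
    represents-cyl X s i (pr n n′) j h | yes en
      with trans (sym (≔-same (mapBase q ∘ s) i _)) (Enumeration.point en i)
    ... | ()

    -- The part is computed from `s` on one side and from the transposed sequence on the other; the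
    -- label sums agree.
    represents-transp : (X : Element {m} κ) → ∀ s i j →
      proj₁ X (mapBase q ∘ s ∘ [ i , j ]) (part s) ≡ represents X (s ∘ [ i , j ])
    represents-transp X@(F , F-adm) s i j with em {P = Enumeration (mapBase q ∘ s ∘ [ i , j ])}
    ... | no ¬en = Admissible.unsplit F-adm _ ¬en _ _
    ... | yes en = cong (λ y → F (mapBase q ∘ s ∘ [ i , j ]) (e y)) (sym (total-transp i j labels≈0))
      where
      en′ : Enumeration (mapBase q ∘ s)
      en′ = subst Enumeration (ext λ k → cong (mapBase q ∘ s) ([,]-involutive i j k)) (enumeration-transp i j en)
      labels≈0 : EventuallyZero (baseLabel ∘ s)
      -- The sequence is viewed as its own update at 0.
      labels≈0 = labels-eventuallyZero s 0 _ (subst Enumeration (sym (ext (≔-self (mapBase q ∘ s) 0))) en′)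

    represents-repl : (X : Element {m} κ) → ∀ s i j →
      proj₁ X (mapBase q ∘ s ∘ [ i / j ]) (part s) ≡ represents X (s ∘ [ i / j ])
    represents-repl X@(F , F-adm) s i j with em {P = Enumeration (mapBase q ∘ s ∘ [ i / j ])}
    ... | no ¬en = Admissible.unsplit F-adm _ ¬en _ _
    ... | yes en with enumeration-repl i j (mapBase q ∘ s) en
    ...   | refl = cong (λ t → F (mapBase q ∘ s ∘ [ i / j ]) (part t)) (ext λ k → cong s (sym ([/]-refl i k)))

    -- Every sequence lifts along `q`, and the lift of an enumeration can be relabelled at entry 0
    -- so as to lie in any given part.
    represents-injective : (X Y : Element {m} κ) → (∀ s → represents X s ≡ represents Y s) →
                           ∀ s j → proj₁ X s j ≡ proj₁ Y s j
    represents-injective X@(F , F-adm) Y@(G , G-adm) X≗Y s j with em {P = Enumeration s}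
    ... | no ¬en = begin
      F s j              ≡⟨ Admissible.unsplit F-adm s ¬en _ _ ⟩
      F s (part t)       ≡⟨ cong (λ s → F s (part t)) qt≡s ⟨
      represents X t     ≡⟨ X≗Y t ⟩
      represents Y t     ≡⟨ cong (λ s → G s (part t)) qt≡s ⟩
      G s (part t)       ≡⟨ Admissible.unsplit G-adm s ¬en _ _ ⟩
      G s j              ∎
      where
      open ≡-Reasoning
      t = mapBase q⁻ ∘ s
      qt≡s : mapBase q ∘ t ≡ s
      qt≡s = ext λ k → mapBase-section qq⁻ (s k)
    ... | yes en = begin
      F s j                            ≡⟨ cong (λ s → F s j) s≡ ⟩
      F ((mapBase q ∘ t) [ 0 ≔ pt n x ]) j  ≡⟨ proj₂ (relabel X t 0 n x j en′) ⟨
      represents X (t [ 0 ≔ pt n y ])  ≡⟨ X≗Y _ ⟩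
      represents Y (t [ 0 ≔ pt n y ])  ≡⟨ proj₂ (relabel Y t 0 n x j en′) ⟩
      G ((mapBase q ∘ t) [ 0 ≔ pt n x ]) j  ≡⟨ cong (λ s → G s j) s≡ ⟨
      G s j                            ∎
      where
      open ≡-Reasoning
      open Enumeration en using (class; label; point)
      t = mapBase q⁻ ∘ s
      n = class 0
      x = label 0
      s≡ : s ≡ (mapBase q ∘ t) [ 0 ≔ pt n x ]
      s≡ = trans (sym (ext (≔-self s 0)))
        (cong₂ (λ s p → s [ 0 ≔ p ]) (sym (ext λ k → mapBase-section qq⁻ (s k))) (point 0))
      en′ = subst Enumeration s≡ en
      -- This label does not depend on the element, so one lift serves both `X` and `Y`.
      y = proj₁ (relabel X t 0 n x j en′)

    module _ (c ℓ κ′ u : Level) where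

      private
        I : Set κ′
        I = ⊤
        P : Set u
        P = Lift u (Base (Label l))
        module A = Algebra (Split {m} κ c ℓ)
        module Q = Algebra (Product I (λ _ → FullSetQEA P))

      rep : A.Carrier → Q.Carrier
      rep (lift X) _ s = Lift u (represents X (lower ∘ s) ≡ true)

      rep-congruent : ∀ {X Y} → X A.≈ Y → rep X Q.≈ rep Y
      rep-congruent (lift p) _ = (λ (lift h) → lift (trans (sym (p _ _)) h)) , (λ (lift h) → lift (trans (p _ _) h))

      rep-injective : ∀ {X Y} → rep X Q.≈ rep Y → X A.≈ Y
      rep-injective {lift X} {lift Y} p = lift (represents-injective X Y λ s →
        bool-ext (λ h → lower (proj₁ (p _) {lift ∘ s} (lift h))) (λ h → lower (proj₂ (p _) {lift ∘ s} (lift h))))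

      rep-homo : ∀ f xs → rep (A.op (qa f) xs) Q.≈ Q.op (qa f) (rep ∘ xs)
      rep-homo bot          xs _ = (λ ()) , (λ ())
      rep-homo top          xs _ = (λ _ → _) , (λ _ → lift refl)
      rep-homo compl        xs _ =
        (λ (lift h) (lift h′) → contradiction (trans (sym h) (cong not h′)) (λ ())) ,
        (λ ¬h → lift (cong not (¬-not (¬h ∘ lift))))
      rep-homo join         xs _ =
        (λ (lift h) → ⊎-map lift lift (∨-elim _ _ h)) ,
        (λ { (inj₁ (lift h)) → lift (∨-introˡ h) ; (inj₂ (lift h)) → lift (∨-introʳ _ h) })
      rep-homo meet         xs _ =
        (λ (lift h) → ×-map lift lift (∧-elim _ _ h)) ,
        (λ (lift h , lift h′) → lift (cong₂ _∧_ h h′))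
      rep-homo (cyl i)      xs _ = (λ {s} → forth s) , (λ {s} → back s)
        where
        X = lower (xs zero)
        lower-update : ∀ s p → lower ∘ (s [ i ≔ lift p ]) ≡ (lower ∘ s) [ i ≔ p ]
        lower-update s p = ext (≔-map lower s i (lift p))
        forth : ∀ s → rep (A.op (qa (cyl i)) xs) _ s → Q.op (qa (cyl i)) (rep ∘ xs) _ s
        forth s (lift h) with truth-elim h
        ... | p , k , h′ with represents-cyl X (lower ∘ s) i p k h′
        ...   | p′ , h″ = lift p′ , lift (trans (cong (represents X) (lower-update s p′)) h″)
        back : ∀ s → Q.op (qa (cyl i)) (rep ∘ xs) _ s → rep (A.op (qa (cyl i)) xs) _ s
        back s (lift p , lift h) = lift (truth-intro (mapBase q p , part ((lower ∘ s) [ i ≔ p ]) ,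
          trans (cong (λ t → proj₁ X t (part ((lower ∘ s) [ i ≔ p ]))) (sym (map-update (lower ∘ s) i p)))
                (trans (cong (represents X) (sym (lower-update s p))) h)))
      rep-homo (repl i j)   xs _ =
        (λ {s} (lift h) → lift (trans (sym (represents-repl (lower (xs zero)) (lower ∘ s) i j)) h)) ,
        (λ {s} (lift h) → lift (trans (represents-repl (lower (xs zero)) (lower ∘ s) i j) h))
      rep-homo (transp i j) xs _ =
        (λ {s} (lift h) → lift (trans (sym (represents-transp (lower (xs zero)) (lower ∘ s) i j)) h)) ,
        (λ {s} (lift h) → lift (trans (represents-transp (lower (xs zero)) (lower ∘ s) i j) h))

      reduct-representable : Rd (Split {m} κ c ℓ) ∈ RQA κ′ u
      reduct-representable = I , (λ _ → P) , record
        { to        = rep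
        ; congruent = λ {X} {Y} → rep-congruent {X} {Y}
        ; homo      = rep-homo
        ; injective = λ {X} {Y} → rep-injective {X} {Y}
        }

      -- The diagonals of `Split` compare entries after projection by `q`; injectivity turns this
      -- into equality in the larger base.
      representable : (∀ {x x′} → q x ≡ q x′ → x ≡ x′) → Split {m} κ c ℓ ∈ RQEA κ′ u
      representable q-injective = I , (λ _ → P) , record
        { to        = rep
        ; congruent = λ {X} {Y} → rep-congruent {X} {Y}
        ; homo      = λ where
            (qa f)     xs → rep-homo f xs
            (diag i j) xs _ →
              (λ {s} (lift h) → cong lift (mapBase-injective q-injective (lower (s i)) (lower (s j)) (truth-elim h))) ,
              (λ eq → lift (truth-intro (cong (mapBase q ∘ lower) eq)))
        ; injective = λ {X} {Y} → rep-injective {X} {Y}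
        }

  -- Nonrepresentability

  data Separated {m : ℕ} : Base (Label m) → Base (Label m) → Set where
    separated : ∀ {n n′ x x′} → n ≢ n′ → Separated (pt n x) (pt n′ x′)

  data Among {m : ℕ} : Base (Label m) → Base (Label m) → Set where
    first  : ∀ {n n′ x} → Among (pt n x) (pr n n′)
    second : ∀ {n n′ x} → Among (pt n′ x) (pr n n′)

  data Offset {m : ℕ} (d : Label m) : Base (Label m) → Base (Label m) → Set where
    offset : ∀ {n x y} → y ≡ d ⊕ x → Offset d (pt n y) (pt n x)

  -- Of the two classes coded by `z`, one is that of `w`; `y` and `x` avoid it and so share the
  -- other.
  common-class : {y x w z : Base (Label m)} → Among y z → Among x z → Among w z →
                 Separated y w → Separated x w → ∃[ d ] Offset d y x
  common-class (first {x = y}) (first {x = x}) _ _ _ = y ⊕ x , offset (⊕-difference y x)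
  common-class (second {x = y}) (second {x = x}) _ _ _ = y ⊕ x , offset (⊕-difference y x)
  common-class first  second first  (separated n≢n) _ = contradiction refl n≢n
  common-class first  second second _ (separated n≢n) = contradiction refl n≢n
  common-class second first  first  _ (separated n≢n) = contradiction refl n≢n
  common-class second first  second (separated n≢n) _ = contradiction refl n≢n

  offset-functional : {d : Label m} {y y′ x : Base (Label m)} → Offset d y x → Offset d y′ x → y ≡ y′
  offset-functional (offset refl) (offset refl) = refl

  Invariant : (Base (Label m) → Base (Label m) → Set) → Set
  Invariant R = ∀ g {p p′} → R p p′ → R (act g p) (act g p′)

  separated-invariant : Invariant (Separated {m})
  separated-invariant g (separated n≢n′) = separated (n≢n′ ∘ Motion.fwd-injective g)

  among-invariant : Invariant (Among {m})
  among-invariant g first  = first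
  among-invariant g second = second

  -- A motion translates all labels of one class by the same amount.
  offset-invariant : (d : Label m) → Invariant (Offset d)
  offset-invariant d g (offset {x = x} refl) = offset (⊕-left-comm _ d x)

  -- Elements that express the obstruction

  module _ {m : ℕ} {J : Set} where

    private
      Elt : Set
      Elt = Element {m} {J} id

    infix 4 _⊑_

    _⊑_ : Elt → Elt → Set
    (F , _) ⊑ (G , _) = ∀ s j → F s j ≡ true → G s j ≡ true

    operation : (f : QEAOp) → (Fin (arity QEA f) → Elt) → Elt
    operation f X = rawOp f (proj₁ ∘ X) , rawOp-admissible id f (proj₂ ∘ X)

    pair : {a : Level} {A : Set a} → A → A → Fin 2 → A
    pair x y zero       = x
    pair x y (suc zero) = y

    infixr 7 _⊓_

    _⊓_ : Elt → Elt → Elt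
    X ⊓ Y = operation (qa meet) (pair X Y)

    cylinder : ℕ → Elt → Elt
    cylinder i X = operation (qa (cyl i)) (λ _ → X)

    swap₀₁ : Elt → Elt
    swap₀₁ X = operation (qa (transp 0 1)) (λ _ → X)

    diagonal : ℕ → ℕ → Elt
    diagonal i j = operation (diag i j) (λ ())

    empty : Elt
    empty = operation (qa bot) (λ ())

    ⋁ : {k : ℕ} → (Label k → Elt) → Elt
    ⋁ {zero}  X = X []
    ⋁ {suc k} X = operation (qa join) (pair (⋁ (X ∘ (false ∷_))) (⋁ (X ∘ (true ∷_))))

    ⊑-⋁ : {k : ℕ} (X : Label k → Elt) (v : Label k) → X v ⊑ ⋁ X
    ⊑-⋁ X []          s j h = h
    ⊑-⋁ X (false ∷ v) s j h = ∨-introˡ (⊑-⋁ (X ∘ (false ∷_)) v s j h)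
    ⊑-⋁ X (true ∷ v)  s j h = ∨-introʳ _ (⊑-⋁ (X ∘ (true ∷_)) v s j h)

    ⊓-elim : (X Y : Elt) → ∀ s j → proj₁ (X ⊓ Y) s j ≡ true → proj₁ X s j ≡ true × proj₁ Y s j ≡ true
    ⊓-elim X Y s j = ∧-elim _ _

    PreservedByMotions : (Seq {m} {J} → J → Set) → Set
    PreservedByMotions P = ∀ g {s j} → P s j → P (act g ∘ s) j

    ConstantOffEnumerations : (Seq {m} {J} → J → Set) → Set
    ConstantOffEnumerations P = ∀ {s} → ¬ Enumeration s → ∀ {j k} → P s j → P s k

    opaque
      -- Preservation in one direction suffices, since the inverse motion supplies the other.
      comprehension : (P : Seq {m} {J} → J → Set) → PreservedByMotions P → ConstantOffEnumerations P → Elt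
      comprehension P inv uns = (λ s j → truth (P s j)) , record
        { invariant = λ g s j → truth-⇔
            (λ h → subst (λ t → P t j) (ext λ i → act-inverseˡ g (s i)) (inv (g ⁻¹) h)) (inv g)
        ; unsplit   = λ s ¬en j k → truth-⇔ (uns ¬en) (uns ¬en)
        ; respects  = λ s eq → cong (λ j → truth (P s j)) eq
        }

      comprehension-intro : ∀ {P} {inv : PreservedByMotions P} {uns : ConstantOffEnumerations P} {s j} →
                            P s j → proj₁ (comprehension P inv uns) s j ≡ true
      comprehension-intro = truth-intro

      comprehension-elim : ∀ {P} {inv : PreservedByMotions P} {uns : ConstantOffEnumerations P} {s j} →
                           proj₁ (comprehension P inv uns) s j ≡ true → P s j
      comprehension-elim = truth-elim

    -- The part `T_j` of the set of all enumerations.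
    piece : J → Elt
    piece j = comprehension (λ s k → Enumeration s × k ≡ j)
      (λ g (en , eq) → enumeration-act g en , eq) (λ ¬en (en , _) → contradiction en ¬en)

    relation : (R : Base (Label m) → Base (Label m) → Set) → Invariant R → ℕ → ℕ → Elt
    relation R inv i i′ = comprehension (λ s _ → R (s i) (s i′)) (λ g → inv g) (λ _ h → h)

    -- The entry at 1 codes the two classes missed by the entries from 2 on.  It
    -- stores in a single coordinate what is needed of an infinite tail, all of
    -- whose coordinates are occupied.
    MissedAt₁ : Seq {m} {J} → Set
    MissedAt₁ s = ∃[ n ] ∃[ x ] ∃[ n′ ] ∃[ x′ ]
      Enumeration ((s [ 0 ≔ pt n x ]) [ 1 ≔ pt n′ x′ ]) × s 1 ≡ pr n n′

    missed : Elt
    missed = comprehension (λ s _ → MissedAt₁ s)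
      (λ g {s} (n , x , n′ , x′ , en , eq) → _ , _ , _ , _ ,
        subst Enumeration (≡-from-2 refl refl (λ _ → refl)) (enumeration-act g en) ,
        cong (act g) eq)
      (λ _ h → h)

    -- The old entry serves as witness, with the part changed to `k`.
    piece-cylinder : ∀ j k → piece j ⊑ cylinder 0 (piece k)
    piece-cylinder j k s _ h = truth-intro
      (s 0 , k , comprehension-intro
        (subst Enumeration (sym (ext (≔-self s 0))) (proj₁ (comprehension-elim h)) , refl))

    piece-swap : ∀ j → piece j ⊑ swap₀₁ (piece j)
    piece-swap j s k h = comprehension-intro (×-map₁ (enumeration-transp 0 1) (comprehension-elim h))

    piece-separated : ∀ j → piece j ⊑ relation Separated separated-invariant 0 1
    piece-separated j s k h = comprehension-intro (subst₂ Separated (sym (point 0)) (sym (point 1))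
      (separated λ eq → contradiction (class-injective eq) (λ ())))
      where open Enumeration (proj₁ (comprehension-elim h))

    piece-missed : ∀ j → piece j ⊑ cylinder 1 missed
    -- The classes missed by the later entries are those of the first two.
    piece-missed j s k h = truth-intro (pr (class 0) (class 1) , k , comprehension-intro
      (_ , label 0 , _ , label 1 ,
       subst Enumeration (≡-from-2 (point 0) (point 1) (λ _ → refl)) en , refl))
      where
      en : Enumeration s
      en = proj₁ (comprehension-elim h)
      open Enumeration en

    -- Some change of entry 1 yields an enumeration, so entry 0 lies in none of the classes met from
    -- entry 2 on. Only the two coded classes are left.
    missed-among : ∀ j → missed ⊓ cylinder 1 (piece j) ⊑ relation Among among-invariant 0 1
    missed-among j s k h
      with comprehension-elim (proj₁ (⊓-elim missed (cylinder 1 (piece j)) s k h))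
         | truth-elim (proj₂ (⊓-elim missed (cylinder 1 (piece j)) s k h))
    ... | n , x , n′ , x′ , d , s₁≡ | p , _ , h′ =
      comprehension-intro (subst₂ Among (sym (e.point 0)) (sym s₁≡)
        (locate (d.position (e.class 0)) (d.class-position _)))
      where
      module d = Enumeration d
      module e = Enumeration (proj₁ (comprehension-elim h′))
      locate : ∀ i → d.class i ≡ e.class 0 → Among (pt (e.class 0) (e.label 0)) (pr n n′)
      locate 0 eq = subst (λ c → Among (pt c (e.label 0)) (pr n n′))
        (trans (proj₁ (pt-injective (d.point 0))) eq) first
      locate 1 eq = subst (λ c → Among (pt c (e.label 0)) (pr n n′))
        (trans (proj₁ (pt-injective (d.point 1))) eq) second
      locate (suc (suc i)) eq = contradiction
        (e.class-injective (trans (sym (proj₁ (pt-injective (trans (sym (d.point (2 + i))) (e.point (2 + i)))))) eq))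
        (λ ())

    disjoint-pieces : ∀ {j k} → j ≢ k → piece j ⊓ piece k ⊑ empty
    disjoint-pieces {j} {k} j≢k s i h with ⊓-elim (piece j) (piece k) s i h
    ... | h₁ , h₂ = contradiction (trans (sym (proj₂ (comprehension-elim h₁))) (proj₂ (comprehension-elim h₂))) j≢k

    -- This is c_i X ≤ X, with the change of part taken into account.
    Stable : ℕ → Elt → Set
    Stable i X = ∀ s p j k → proj₁ X (s [ i ≔ p ]) j ≡ true → proj₁ X s k ≡ true

    relation-stable : ∀ R inv {i i′} n → n ≢ i → n ≢ i′ → Stable n (relation R inv i i′)
    relation-stable R _ n n≢i n≢i′ s p j k h =
      comprehension-intro (subst₂ R (≔-other s n p n≢i) (≔-other s n p n≢i′) (comprehension-elim h))

    missed-stable : Stable 0 missed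
    missed-stable s p j k h with comprehension-elim h
    ... | n , x , n′ , x′ , en , eq = comprehension-intro (n , x , n′ , x′ ,
      subst Enumeration (≡-from-2 refl refl (λ _ → refl)) en , eq)

    -- Counting parts in a hypothetical representation

    module _ {c ℓ κ u : Level} {K : Set κ} {B : K → Set u}
             (emb : Embedding (Split {m} {J} id c ℓ) (Product K (λ k → FullSetQEA (B k)))) where

      open Embedding emb

      -- If all components of the image were empty, injectivity would identify the piece with
      -- `empty`, but it contains the standard enumeration.
      piece-inhabited : ∀ j → ∃[ k ] ∃[ s ] to (lift (piece j)) k s
      piece-inhabited j with em {P = ∃[ k ] ∃[ s ] to (lift (piece j)) k s}
      ... | yes inhabited = inhabited
      ... | no  ¬inhabited = contradiction
        (trans (sym (comprehension-intro (standard-enumeration , refl))) (lower (injective same) standard j)) (λ ())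
        where
        same : Algebra._≈_ (Product K (λ k → FullSetQEA (B k))) (to (lift (piece j))) (to (lift empty))
        same k = (λ h → contradiction (k , _ , h) ¬inhabited) ,
                 (λ h → contradiction
                   (lower (proj₁ (homo (qa bot) (λ ()) k)
                     (proj₁ (congruent {lift empty} (lift λ _ _ → refl) k) h))) λ ())

      module _ (k : K) where

        ⟪_⟫ : Elt → Pred (ℕ → B k) u
        ⟪ X ⟫ = to (lift X) k

        same-raw : (X Y : Elt) → (∀ s j → proj₁ X s j ≡ proj₁ Y s j) → ∀ {s} → s ∈ ⟪ X ⟫ → s ∈ ⟪ Y ⟫
        same-raw X Y eq = proj₁ (congruent {lift X} {lift Y} (lift eq) k)

        opaque
          ⟪⟫-op : ∀ f X {s} → s ∈ ⟪ operation f X ⟫ → s ∈ Algebra.op (FullSetQEA (B k)) f (λ i → ⟪ X i ⟫)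
          ⟪⟫-op f X h = proj₁ (homo f (lift ∘ X) k) h

          op-⟪⟫ : ∀ f X {s} → s ∈ Algebra.op (FullSetQEA (B k)) f (λ i → ⟪ X i ⟫) → s ∈ ⟪ operation f X ⟫
          op-⟪⟫ f X h = proj₂ (homo f (lift ∘ X) k) h

        ⊓-intro : (X Y : Elt) → ∀ {s} → s ∈ ⟪ X ⟫ → s ∈ ⟪ Y ⟫ → s ∈ ⟪ X ⊓ Y ⟫
        ⊓-intro X Y h h′ = op-⟪⟫ (qa meet) (pair X Y) (h , h′)

        opaque
          -- Inclusion is the equation X = X ⊓ Y, which the embedding preserves.
          ⊑-mono : (X Y : Elt) → X ⊑ Y → ∀ {s} → s ∈ ⟪ X ⟫ → s ∈ ⟪ Y ⟫
          ⊑-mono X Y X⊑Y h = proj₂ (⟪⟫-op (qa meet) (pair X Y) (same-raw X (X ⊓ Y)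
            (λ s j → bool-ext (λ x → cong₂ _∧_ x (X⊑Y s j x)) (λ xy → proj₁ (⊓-elim X Y s j xy))) h))

        opaque
          ⋁-elim : ∀ {n} (X : Label n → Elt) {s} → s ∈ ⟪ ⋁ X ⟫ → ∃[ v ] s ∈ ⟪ X v ⟫
          ⋁-elim {zero}  X h = [] , h
          ⋁-elim {suc n} X h with ⟪⟫-op (qa join) (pair (⋁ (X ∘ (false ∷_))) (⋁ (X ∘ (true ∷_)))) h
          ... | inj₁ h₀ = ×-map (false ∷_) id (⋁-elim (X ∘ (false ∷_)) h₀)
          ... | inj₂ h₁ = ×-map (true ∷_) id (⋁-elim (X ∘ (true ∷_)) h₁)

        opaque
          -- The old entry `s i` witnesses that the updated sequence lies in the cylinder of `X`,
          -- which is below `X`.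
          update : ∀ i X → Stable i X → ∀ {s} b → s ∈ ⟪ X ⟫ → (s [ i ≔ b ]) ∈ ⟪ X ⟫
          update i X stable {s} b h = ⊑-mono (cylinder i X) X
            (λ s j h → let (p , j′ , h′) = truth-elim h in stable s p j′ j h′)
            (op-⟪⟫ (qa (cyl i)) (λ _ → X)
              (s i , subst ⟪ X ⟫ (sym (trans (ext (≔-idem s i b (s i))) (ext (≔-self s i)))) h))

        opaque
          -- Equal entries put the sequence into the images of the diagonals, and the replacement of
          -- equals holds as an inclusion in `Split`.
          relation-move : ∀ R inv i i′ n n′ {s} → s i ≡ s n → s i′ ≡ s n′ →
                          s ∈ ⟪ relation R inv i i′ ⟫ → s ∈ ⟪ relation R inv n n′ ⟫
          relation-move R inv i i′ n n′ eq eq′ h =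
            ⊑-mono (diagonal i n ⊓ diagonal i′ n′ ⊓ relation R inv i i′) (relation R inv n n′)
              (λ s j h → let (h₁ , h₂₃) = ⊓-elim (diagonal i n) (diagonal i′ n′ ⊓ relation R inv i i′) s j h
                             (h₂ , h₃) = ⊓-elim (diagonal i′ n′) (relation R inv i i′) s j h₂₃
                         in comprehension-intro (subst₂ R (truth-elim h₁) (truth-elim h₂) (comprehension-elim h₃)))
              (⊓-intro _ _ (op-⟪⟫ (diag i n) _ eq) (⊓-intro _ _ (op-⟪⟫ (diag i′ n′) _ eq′) h))

        module _ (s : ℕ → B k) where

          -- The argument changes only the first four entries and keeps the tail of `s`.
          quad : (a b c d : B k) → ℕ → B k
          quad a b c d 0 = a
          quad a b c d 1 = b
          quad a b c d 2 = c
          quad a b c d 3 = d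
          quad a b c d n = s n

          update₀ : ∀ X → Stable 0 X → ∀ {a b c d} a′ → quad a b c d ∈ ⟪ X ⟫ → quad a′ b c d ∈ ⟪ X ⟫
          update₀ X st a′ h = subst ⟪ X ⟫ (≡-from-4 refl refl refl refl (λ _ → refl)) (update 0 X st a′ h)

          update₁ : ∀ X → Stable 1 X → ∀ {a b c d} b′ → quad a b c d ∈ ⟪ X ⟫ → quad a b′ c d ∈ ⟪ X ⟫
          update₁ X st b′ h = subst ⟪ X ⟫ (≡-from-4 refl refl refl refl (λ _ → refl)) (update 1 X st b′ h)

          update₂₃ : ∀ X → Stable 2 X → Stable 3 X → ∀ {a b c d} c′ d′ →
                     quad a b c d ∈ ⟪ X ⟫ → quad a b c′ d′ ∈ ⟪ X ⟫
          update₂₃ X st₂ st₃ c′ d′ h = subst ⟪ X ⟫ (≡-from-4 refl refl refl refl (λ _ → refl))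
            (update 3 X st₃ d′ (update 2 X st₂ c′ h))

          among : ℕ → ℕ → Elt
          among = relation Among among-invariant

          apart : ℕ → ℕ → Elt
          apart = relation Separated separated-invariant

          shifted : Label m → ℕ → ℕ → Elt
          shifted d = relation (Offset d) (offset-invariant d)

          -- This is `common-class` with y, z, x, w as entries 0 to 3, put as an inclusion so that
          -- it passes through the embedding. The join is finite and therefore preserved.
          common-offset : among 0 1 ⊓ among 2 1 ⊓ among 3 1 ⊓ apart 0 3 ⊓ apart 2 3 ⊑ ⋁ (λ d → shifted d 0 2)
          common-offset t j h =
            let (h₁ , r₁) = ⊓-elim (among 0 1) (among 2 1 ⊓ among 3 1 ⊓ apart 0 3 ⊓ apart 2 3) t j h
                (h₂ , r₂) = ⊓-elim (among 2 1) (among 3 1 ⊓ apart 0 3 ⊓ apart 2 3) t j r₁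
                (h₃ , r₃) = ⊓-elim (among 3 1) (apart 0 3 ⊓ apart 2 3) t j r₂
                (h₄ , h₅) = ⊓-elim (apart 0 3) (apart 2 3) t j r₃
                (d , off) = common-class (comprehension-elim h₁) (comprehension-elim h₂) (comprehension-elim h₃)
                                         (comprehension-elim h₄) (comprehension-elim h₅)
            in ⊑-⋁ (λ d → shifted d 0 2) d t j (comprehension-intro off)

          same-offset : ∀ d → shifted d 0 2 ⊓ shifted d 1 2 ⊑ diagonal 0 1
          same-offset d t j h =
            let (h₁ , h₂) = ⊓-elim (shifted d 0 2) (shifted d 1 2) t j h
            in truth-intro (offset-functional (comprehension-elim h₁) (comprehension-elim h₂))

          -- With `y` and `y′` side by side in entries 0 and 1, both have offset `d` from `x` in
          -- entry 2, which forces the diagonal.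
          equal-entries : ∀ {d z x w y y′} → quad y z x w ∈ ⟪ shifted d 0 2 ⟫ →
                          quad y′ z x w ∈ ⟪ shifted d 0 2 ⟫ → y ≡ y′
          equal-entries {d} {y = y} {y′} hy hy′ = ⟪⟫-op (diag 0 1) (λ ())
            (⊑-mono (shifted d 0 2 ⊓ shifted d 1 2) (diagonal 0 1) (same-offset d)
              (⊓-intro (shifted d 0 2) (shifted d 1 2)
                (update₁ (shifted d 0 2) (relation-stable (Offset d) (offset-invariant d) 1 (λ ()) (λ ())) y′ hy)
                (update₀ (shifted d 1 2) (relation-stable (Offset d) (offset-invariant d) 0 (λ ()) (λ ())) y
                  (relation-move (Offset d) (offset-invariant d) 0 2 1 2 refl refl
                    (update₁ (shifted d 0 2) (relation-stable (Offset d) (offset-invariant d) 1 (λ ()) (λ ())) y′ hy′)))))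

          equal-pieces : ∀ {b c d y i j} → quad y b c d ∈ ⟪ piece i ⟫ → quad y b c d ∈ ⟪ piece j ⟫ → i ≡ j
          equal-pieces {i = i} {j} hi hj with em {P = i ≡ j}
          ... | yes i≡j = i≡j
          ... | no  i≢j = contradiction
            (lower (⟪⟫-op (qa bot) (λ ()) (⊑-mono (piece i ⊓ piece j) empty (disjoint-pieces i≢j)
              (⊓-intro (piece i) (piece j) hi hj))))
            (λ ())

          -- The entry `y` moves `s` into piece `j`, and `d` is its offset from `s 0`, which is kept
          -- in entry 2.
          Located : B k → J → Set u
          Located z j = ∃[ y ] ∃[ d ]
            quad y (s 1) (s 2) (s 3) ∈ ⟪ piece j ⟫ × quad y z (s 0) (s 1) ∈ ⟪ shifted d 0 2 ⟫

          -- The offset determines `y`, and `y` determines the piece, so the offsets count the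
          -- parts.
          located-injective : ∀ {z i j} (p : Located z i) (q : Located z j) →
                              proj₁ (proj₂ p) ≡ proj₁ (proj₂ q) → i ≡ j
          located-injective {i = i} {j} (y , d , hi , hy) (y′ , .d , hj , hy′) refl
            with equal-entries {d} hy hy′
          ... | refl = equal-pieces {i = i} {j} hi hj

          locate-pieces : ∀ {j₀} → s ∈ ⟪ piece j₀ ⟫ → ∃[ z ] ∀ j → Located z j
          locate-pieces {j₀} h = z , λ j →
            let (y , hj) = entry j ; (d , hd) = offset-exists {j} hj in y , d , hj , hd
            where
            x = s 0
            w = s 1
            c′ = s 2
            d′ = s 3

            start : quad x w c′ d′ ∈ ⟪ piece j₀ ⟫
            start = subst ⟪ piece j₀ ⟫ (≡-from-4 refl refl refl refl (λ _ → refl)) h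

            entry : ∀ j → ∃[ y ] quad y w c′ d′ ∈ ⟪ piece j ⟫
            entry j with ⟪⟫-op (qa (cyl 0)) (λ _ → piece j)
              (⊑-mono (piece j₀) (cylinder 0 (piece j)) (piece-cylinder j₀ j) start)
            ... | y , hy = y , subst ⟪ piece j ⟫ (≡-from-4 refl refl refl refl (λ _ → refl)) hy

            -- One code serves all pieces, since `missed` is stable at entry 0.
            classes : ∃[ z ] quad x z c′ d′ ∈ ⟪ missed ⟫
            classes with ⟪⟫-op (qa (cyl 1)) (λ _ → missed)
              (⊑-mono (piece j₀) (cylinder 1 missed) (piece-missed j₀) start)
            ... | z , hz = z , subst ⟪ missed ⟫ (≡-from-4 refl refl refl refl (λ _ → refl)) hz

            z = proj₁ classes

            -- With `w` in entry 0, `among-z` applies to `w` too.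
            swapped : quad w x c′ d′ ∈ ⟪ piece j₀ ⟫
            swapped = subst ⟪ piece j₀ ⟫ (≡-from-4 refl refl refl refl (λ _ → refl))
              (⟪⟫-op (qa (transp 0 1)) (λ _ → piece j₀) (⊑-mono (piece j₀) (swap₀₁ (piece j₀)) (piece-swap j₀) start))

            -- Once the relation between `a` and `z` is established, entries 2 and 3 are free to
            -- hold `x` and `w`.
            among-z : ∀ {a b j} → quad a b c′ d′ ∈ ⟪ piece j ⟫ → quad a z x w ∈ ⟪ among 0 1 ⟫
            among-z {a} {b} {j} hj = update₂₃ (among 0 1)
              (relation-stable Among among-invariant 2 (λ ()) (λ ()))
              (relation-stable Among among-invariant 3 (λ ()) (λ ())) x w
              (⊑-mono (missed ⊓ cylinder 1 (piece j)) (among 0 1) (missed-among j)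
                (⊓-intro missed (cylinder 1 (piece j))
                  (update₀ missed missed-stable a (proj₂ classes))
                  (op-⟪⟫ (qa (cyl 1)) (λ _ → piece j) (b ,
                    subst ⟪ piece j ⟫ (≡-from-4 refl refl refl refl (λ _ → refl)) hj))))

            apart-w : ∀ {a j} → quad a w c′ d′ ∈ ⟪ piece j ⟫ → quad a w x w ∈ ⟪ apart 0 1 ⟫
            apart-w {a} {j} hj = update₂₃ (apart 0 1)
              (relation-stable Separated separated-invariant 2 (λ ()) (λ ()))
              (relation-stable Separated separated-invariant 3 (λ ()) (λ ())) x w
              (⊑-mono (piece j) (apart 0 1) (piece-separated j) hj)

            offset-exists : ∀ {j y} → quad y w c′ d′ ∈ ⟪ piece j ⟫ → ∃[ d ] quad y z x w ∈ ⟪ shifted d 0 2 ⟫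
            offset-exists {y = y} hy = ⋁-elim (λ d → shifted d 0 2)
              (⊑-mono (among 0 1 ⊓ among 2 1 ⊓ among 3 1 ⊓ apart 0 3 ⊓ apart 2 3)
                (⋁ λ d → shifted d 0 2) common-offset
                (⊓-intro (among 0 1) (among 2 1 ⊓ among 3 1 ⊓ apart 0 3 ⊓ apart 2 3) (among-z hy)
                (⊓-intro (among 2 1) (among 3 1 ⊓ apart 0 3 ⊓ apart 2 3) x-among-z
                (⊓-intro (among 3 1) (apart 0 3 ⊓ apart 2 3) w-among-z
                (⊓-intro (apart 0 3) (apart 2 3) y-apart-w x-apart-w)))))
              where
              x-among-z : quad y z x w ∈ ⟪ among 2 1 ⟫
              x-among-z = update₀ (among 2 1) (relation-stable Among among-invariant 0 (λ ()) (λ ())) y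
                (relation-move Among among-invariant 0 1 2 1 refl refl (among-z start))
              w-among-z : quad y z x w ∈ ⟪ among 3 1 ⟫
              w-among-z = update₀ (among 3 1) (relation-stable Among among-invariant 0 (λ ()) (λ ())) y
                (relation-move Among among-invariant 0 1 3 1 refl refl (among-z swapped))
              y-apart-w : quad y z x w ∈ ⟪ apart 0 3 ⟫
              y-apart-w = update₁ (apart 0 3) (relation-stable Separated separated-invariant 1 (λ ()) (λ ())) z
                (relation-move Separated separated-invariant 0 1 0 3 refl refl (apart-w hy))
              x-apart-w : quad y z x w ∈ ⟪ apart 2 3 ⟫
              x-apart-w = update₁ (apart 2 3) (relation-stable Separated separated-invariant 1 (λ ()) (λ ())) z
                (update₀ (apart 2 3) (relation-stable Separated separated-invariant 0 (λ ()) (λ ())) y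
                  (relation-move Separated separated-invariant 0 1 2 3 refl refl (apart-w start)))

          labelling : (∃[ z ] ∀ j → Located z j) → Σ[ f ∈ (J → Label m) ] (∀ {i j} → f i ≡ f j → i ≡ j)
          labelling (z , located) =
            (λ j → proj₁ (proj₂ (located j))) , λ {i} {j} → located-injective (located i) (located j)

      pieces-bounded : J → Σ[ f ∈ (J → Label m) ] (∀ {i j} → f i ≡ f j → i ≡ j)
      pieces-bounded j₀ with piece-inhabited j₀
      ... | k , s , h = labelling k s (locate-pieces k s {j₀} h)

  -- Subalgebras generated by finitely many elements

  map-agree : {f g : ℕ → Bool} (V : List ℕ) → Vec-map f (fromList V) ≡ Vec-map g (fromList V) →
              ∀ {x} → x ∈ˡ V → f x ≡ g x
  map-agree (x ∷ˡ V) eq (here refl) = proj₁ (∷-injective eq)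
  map-agree (x ∷ˡ V) eq (there x∈V) = map-agree V (proj₂ (∷-injective eq)) x∈V

  -- The elements v x with x ∈ V tell j and k apart only if key j ≢ key k.  There
  -- are no more keys than labels, so merging the parts with equal keys leaves few
  -- enough of them for a representation with classes of the original size.
  module _ {J : Set} (j₀ : J) (V : List ℕ) {c ℓ : Level}
    (v : ℕ → Algebra.Carrier (Split {suc (length V)} {J} id c ℓ)) where

    key : J → Label (suc (length V))
    -- The leading `false` pads keys to labels of positive length, the length at which `collapse` is
    -- available.
    key j = false ∷ Vec-map (λ x → proj₁ (lower (v x)) standard j) (fromList V)

    -- Labels that are not keys get the default `j₀`.
    keyholder : Label (suc (length V)) → J
    keyholder y with em {P = ∃[ j ] key j ≡ y}
    ... | yes (j , _) = j
    ... | no  _       = j₀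

    key-keyholder : ∀ j → key (keyholder (key j)) ≡ key j
    key-keyholder j with em {P = ∃[ k ] key k ≡ key j}
    ... | yes (_ , eq) = eq
    ... | no  ¬key     = contradiction (j , refl) ¬key

    generated-representable : (κ u : Level) → Split {suc (length V)} key c ℓ ∈ RQEA κ u
    generated-representable κ u =
      Representation.representable key keyholder key-keyholder id id (λ _ → refl) (λ _ → id) c ℓ κ u id

    -- On enumerations everything is decided at `standard`, where the key records the values of the
    -- generators.
    generator-admissible : ∀ {x} → x ∈ˡ V → Admissible key (proj₁ (lower (v x)))
    generator-admissible {x} x∈V = record
      { invariant = invariant
      ; unsplit   = unsplit
      ; respects  = respects-key
      }
      where
      F = proj₁ (lower (v x))
      open Admissible (proj₂ (lower (v x)))
      respects-key : ∀ s {j k} → key j ≡ key k → F s j ≡ F s k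
      respects-key s {j} {k} eq with em {P = Enumeration s}
      ... | no ¬en = unsplit s ¬en j k
      ... | yes en = trans (orbit id (lower (v x)) en standard-enumeration j)
        (trans (map-agree V (proj₂ (∷-injective eq)) x∈V)
               (orbit id (lower (v x)) standard-enumeration en k))

    restricted : ℕ → Algebra.Carrier (Split {suc (length V)} key c ℓ)
    restricted x with em {P = x ∈ˡ V}
    ... | yes x∈V = lift (proj₁ (lower (v x)) , generator-admissible x∈V)
    ... | no  _   = Algebra.op (Split key c ℓ) (qa bot) (λ ())

    restricted-agree : ∀ {x} → x ∈ˡ V → Algebra._≈_ (Split {suc (length V)} id c ℓ)
                       (Embedding.to (inclusion key c ℓ) (restricted x)) (v x)
    restricted-agree {x} x∈V with em {P = x ∈ˡ V}
    ... | yes _   = lift λ _ _ → refl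
    ... | no  x∉V = contradiction x∈V x∉V

  -- Each valuation gets its own representable subalgebra, containing the values of the variables in
  -- `V`. Embeddings transfer only quantifier-free formulas, hence the passage to the matrix.
  split-models : {J : Set} → J → {c ℓ s : Level} (κ u : Level)
                 (Γ : Pred (UniversalFormula QEA) s) (V : List ℕ) →
                 (∀ φ → φ ∈ Γ → VarsIn V φ) →
                 ((A : Algebra QEA c ℓ) → A ∈ RQEA κ u → A ⊨ Γ) →
                 Split {suc (length V)} {J} id c ℓ ⊨ Γ
  split-models {J} j₀ {c} {ℓ} κ u Γ V vars sound φ φ∈Γ = holds-from-matrix (Split id c ℓ) φ λ v →
    Equivalence.to
      (qf-preserved (inclusion (key j₀ V {c} {ℓ} v) c ℓ) V (λ {x} → restricted-agree j₀ V v {x})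
        (matrix φ) (matrix-vars φ (vars φ φ∈Γ)))
      (matrix-holds (Generated v) ext φ (restricted j₀ V v)
        (sound (Generated v) (generated-representable j₀ V v κ u) φ φ∈Γ (restricted j₀ V v)))
    where
    Generated : (ℕ → Algebra.Carrier (Split {suc (length V)} {J} id c ℓ)) → Algebra QEA c ℓ
    Generated v = Split {suc (length V)} (key j₀ V {c} {ℓ} v) c ℓ

  -- Without diagonals a class may be blown up to the size of Label (2 + m).  Only
  -- 𝟘 is sent to 𝟘, so that lifts of enumerations have eventually zero labels.
  collapse : Label (2 + m) → Label (1 + m)
  collapse (false ∷ x) = x
  collapse (true ∷ x)  = replicate _ true

  -- A label starting with `true` goes to the all-true label, which has positive length and so
  -- differs from `𝟘`.
  collapse-reflects-𝟘 : (x : Label (2 + m)) → collapse x ≡ 𝟘 → x ≡ 𝟘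
  collapse-reflects-𝟘 (false ∷ x) eq = cong (false ∷_) eq

  -- The enlarged classes have as many points as there are parts, so the label sum itself names the
  -- part.
  split-reduct-representable : (c ℓ κ u : Level) → Rd (Split {1 + m} {Label (2 + m)} id c ℓ) ∈ RQA κ u
  split-reduct-representable =
    Representation.reduct-representable id id (λ _ → refl) collapse (false ∷_) (λ _ → refl) collapse-reflects-𝟘

  split-not-representable : {c ℓ κ u : Level} → ¬ (Split {m} {Label (suc m)} id c ℓ ∈ RQEA κ u)
  split-not-representable (K , B , emb) = let (f , f-injective) = pieces-bounded emb 𝟘 in
    no-label-injection f f-injective

mainTheorem2 : (∀ {a} → ExcludedMiddle a) →
    (∀ {a b} → Extensionality a b) →
    {c ℓ κ u s : Level} →
    ¬ (Σ[ Γ ∈ Pred (UniversalFormula QEA) s ]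
    FinitelyManyVariables Γ
    × ((A : Algebra QEA c ℓ) → A ∈ RQEA κ u → A ⊨ Γ)
    × ((A : Algebra QEA c ℓ) → A ⊨ Γ → Rd A ∈ RQA κ u → A ∈ RQEA κ u))
mainTheorem2 em ext {c} {ℓ} {κ} {u} (Γ , (V , vars) , sound , complete) =
  -- With `m = 1 + length V`, classes have `2 ^ m` points and there are `2 ^ (1 + m)` parts: too
  -- many for a representation, but formulas over `V` cannot tell.
  split-not-representable
    (complete (Split id c ℓ) (split-models 𝟘 κ u Γ V vars sound) (split-reduct-representable c ℓ κ u))
  where open Classical em ext
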